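{- Let $\varphi$ be a positive, non-increasing function defined on the set of positive integers such that $\varphi(1)=1$, $\lim_{q\to+\infty}\varphi(q)=0$ and $\lim_{q\to+\infty} q\varphi(q)=+\infty$. Let $\alpha$ be a real number in $\mathbf{Bad}$. Then there exists an uncountable subset $B_\varphi(\alpha)$ of $\mathbf{Bad}$ such that, for every $\beta\in B_\varphi(\alpha)$, there exist infinitely many positive integers $q$ with $$ q\cdot\Vert q\alpha\Vert\cdot\Vert q\beta\Vert \le \frac{1}{q\cdot\varphi(q)}. $$ In particular, for every $\beta\in B_\varphi(\alpha)$ one has $\inf_{q\ge1} q\cdot\Vert q\alpha\Vert\cdot\Vert q\beta\Vert=0$. Furthermore, the set $B_\varphi(\alpha)$ can be effectively constructed.
   Context: For a real number $x$, $\Vert x\Vert$ denotes the distance from $x$ to the nearest integer. $\mathbf{Bad}=\{\alpha\in\mathbb{R} : \inf_{q\ge1} q\cdot\Vert q\alpha\Vert>0\}$ is the set of badly approximable numbers; equivalently, the set of real numbers whose continued fraction expansion has bounded partial quotients. -}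

module Defs where

open import Data.Bool.Base using (Bool; true; false)
open import Data.Integer.Base as ℤ using (ℤ; +_; -[1+_])
import Data.Integer.DivMod as ℤ
import Data.Integer.Properties as ℤ
open import Data.Nat.Base as ℕ using (ℕ; suc; NonZero)
open import Data.Nat.Coprimality using (sym; 1-coprimeTo)
import Data.Nat.Properties as ℕ
open import Data.Product.Base using (∃; _×_; _,_; proj₁; proj₂)
open import Data.Rational.Base as ℚ using (ℚ; 0ℚ; 1ℚ; ½; mkℚ)
import Data.Rational.Properties as ℚ
open import Data.Rational.Solver using (module +-*-Solver)
open import Data.Sum.Base using (_⊎_; inj₁; inj₂; [_,_]′)
open import Function.Bundles using (_⇔_)
open import Level using (0ℓ)
open import Relation.Binary.Core using (Rel)
open import Relation.Binary.Definitions using (tri<; tri≈; tri>)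
open import Relation.Binary.PropositionalEquality.Core as ≡
  using (_≡_; refl; cong; cong₂; subst; _≗_)
open import Relation.Unary using (Pred; _∈_)

module _ where
  open +-*-Solver

  q+[p-q]≡p : ∀ p q → q ℚ.+ (p ℚ.- q) ≡ p
  q+[p-q]≡p = solve 2 (λ p q → q :+ (p :- q) := p) refl

  [q+d]-q≡d : ∀ q d → q ℚ.+ d ℚ.- q ≡ d
  [q+d]-q≡d = solve 2 (λ q d → q :+ d :- q := d) refl

  -[p-q]≡q-p : ∀ p q → ℚ.- (p ℚ.- q) ≡ q ℚ.- p
  -[p-q]≡q-p = solve 2 (λ p q → :- (p :- q) := q :- p) refl

  [p-q]+[q-r]≡p-r : ∀ p q r → (p ℚ.- q) ℚ.+ (q ℚ.- r) ≡ p ℚ.- r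
  [p-q]+[q-r]≡p-r = solve 3 (λ p q r → (p :- q) :+ (q :- r) := p :- r) refl

  [p-q]-[r-s]≡[p-r]-[q-s] : ∀ p q r s →
    (p ℚ.- q) ℚ.- (r ℚ.- s) ≡ (p ℚ.- r) ℚ.- (q ℚ.- s)
  [p-q]-[r-s]≡[p-r]-[q-s] =
    solve 4 (λ p q r s → (p :- q) :- (r :- s) := (p :- r) :- (q :- s)) refl

  pr-qs≡p[r-s]+[p-q]s : ∀ p q r s →
    p ℚ.* r ℚ.- q ℚ.* s ≡ p ℚ.* (r ℚ.- s) ℚ.+ (p ℚ.- q) ℚ.* s
  pr-qs≡p[r-s]+[p-q]s =
    solve 4 (λ p q r s → p :* r :- q :* s := p :* (r :- s) :+ (p :- q) :* s) refl

  k[ei]+[ei]l≡e[[k+l]i] : ∀ k l e i →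
    k ℚ.* (e ℚ.* i) ℚ.+ e ℚ.* i ℚ.* l ≡ e ℚ.* ((k ℚ.+ l) ℚ.* i)
  k[ei]+[ei]l≡e[[k+l]i] =
    solve 4 (λ k l e i → k :* (e :* i) :+ e :* i :* l := e :* ((k :+ l) :* i)) refl

  pqr≡q[pr] : ∀ p q r → p ℚ.* q ℚ.* r ≡ q ℚ.* (p ℚ.* r)
  pqr≡q[pr] = solve 3 (λ p q r → p :* q :* r := q :* (p :* r)) refl

  i[bj]-j[ai]≡[b-a][ij] : ∀ a b i j →
    i ℚ.* (b ℚ.* j) ℚ.- j ℚ.* (a ℚ.* i) ≡ (b ℚ.- a) ℚ.* (i ℚ.* j)
  i[bj]-j[ai]≡[b-a][ij] =
    solve 4 (λ a b i j → i :* (b :* j) :- j :* (a :* i) := (b :- a) :* (i :* j)) refl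

  e[ss][rr]≡e[[sr][sr]] : ∀ e s r →
    e ℚ.* (s ℚ.* s) ℚ.* (r ℚ.* r) ≡ e ℚ.* ((s ℚ.* r) ℚ.* (s ℚ.* r))
  e[ss][rr]≡e[[sr][sr]] =
    solve 3 (λ e s r → e :* (s :* s) :* (r :* r) := e :* ((s :* r) :* (s :* r))) refl

module _ where
  open ℚ.≤-Reasoning

  ε/2 : ℚ → ℚ
  ε/2 ε = ε ℚ.* ½

  ε/2-pos : ∀ {ε} → 0ℚ ℚ.< ε → 0ℚ ℚ.< ε/2 ε
  ε/2-pos {ε} ε>0 =
    subst (ℚ._< ε/2 ε) (ℚ.*-zeroˡ ½) (ℚ.*-monoˡ-<-pos ½ ε>0)

  ε/2+ε/2 : ∀ ε → ε/2 ε ℚ.+ ε/2 ε ≡ ε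
  ε/2+ε/2 ε = ≡.trans (≡.sym (ℚ.*-distribˡ-+ ε ½ ½)) (ℚ.*-identityʳ ε)

  *-pos-ℚ : ∀ {p q} → 0ℚ ℚ.< p → 0ℚ ℚ.< q → 0ℚ ℚ.< p ℚ.* q
  *-pos-ℚ {p} {q} p>0 q>0 =
    subst (ℚ._< p ℚ.* q) (ℚ.*-zeroˡ q)
      (ℚ.*-monoˡ-<-pos q {{ℚ.positive q>0}} p>0)

  *-mono-ℚ : ∀ {p q r s} → 0ℚ ℚ.≤ p → 0ℚ ℚ.≤ s →
             p ℚ.≤ q → r ℚ.≤ s → p ℚ.* r ℚ.≤ q ℚ.* s
  *-mono-ℚ {p} {q} {r} {s} p≥0 s≥0 p≤q r≤s = ℚ.≤-trans
    (ℚ.*-monoˡ-≤-nonNeg p {{ℚ.nonNegative p≥0}} r≤s)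
    (ℚ.*-monoʳ-≤-nonNeg s {{ℚ.nonNegative s≥0}} p≤q)

  ∣p-q∣≡∣q-p∣ : ∀ p q → ℚ.∣ p ℚ.- q ∣ ≡ ℚ.∣ q ℚ.- p ∣
  ∣p-q∣≡∣q-p∣ p q = ≡.trans (≡.sym (ℚ.∣-p∣≡∣p∣ (p ℚ.- q)))
    (cong ℚ.∣_∣ (-[p-q]≡q-p p q))

  ∣p-r∣≤∣p-q∣+∣q-r∣ : ∀ p q r →
    ℚ.∣ p ℚ.- r ∣ ℚ.≤ ℚ.∣ p ℚ.- q ∣ ℚ.+ ℚ.∣ q ℚ.- r ∣
  ∣p-r∣≤∣p-q∣+∣q-r∣ p q r = begin
    ℚ.∣ p ℚ.- r ∣                   ≡⟨ cong ℚ.∣_∣ ([p-q]+[q-r]≡p-r p q r) ⟨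
    ℚ.∣ (p ℚ.- q) ℚ.+ (q ℚ.- r) ∣   ≤⟨ ℚ.∣p+q∣≤∣p∣+∣q∣ (p ℚ.- q) (q ℚ.- r) ⟩
    ℚ.∣ p ℚ.- q ∣ ℚ.+ ℚ.∣ q ℚ.- r ∣ ∎

  ∣p∣≤∣q∣+∣p-q∣ : ∀ p q → ℚ.∣ p ∣ ℚ.≤ ℚ.∣ q ∣ ℚ.+ ℚ.∣ p ℚ.- q ∣
  ∣p∣≤∣q∣+∣p-q∣ p q = begin
    ℚ.∣ p ∣                   ≡⟨ cong ℚ.∣_∣ (q+[p-q]≡p p q) ⟨
    ℚ.∣ q ℚ.+ (p ℚ.- q) ∣     ≤⟨ ℚ.∣p+q∣≤∣p∣+∣q∣ q (p ℚ.- q) ⟩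
    ℚ.∣ q ∣ ℚ.+ ℚ.∣ p ℚ.- q ∣ ∎

  ∣p∣≤q : ∀ {p q} → p ℚ.≤ q → ℚ.- p ℚ.≤ q → ℚ.∣ p ∣ ℚ.≤ q
  ∣p∣≤q {p} {q} p≤q -p≤q with ℚ.∣p∣≡p∨∣p∣≡-p p
  ... | inj₁ eq = subst (ℚ._≤ q) (≡.sym eq) p≤q
  ... | inj₂ eq = subst (ℚ._≤ q) (≡.sym eq) -p≤q

  ∣p-q∣≤d : ∀ {p q d} → p ℚ.≤ q ℚ.+ d → q ℚ.≤ p ℚ.+ d → ℚ.∣ p ℚ.- q ∣ ℚ.≤ d
  ∣p-q∣≤d {p} {q} {d} p≤q+d q≤p+d = ∣p∣≤q
    (begin
      p ℚ.- q         ≤⟨ ℚ.+-monoˡ-≤ (ℚ.- q) p≤q+d ⟩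
      q ℚ.+ d ℚ.- q   ≡⟨ [q+d]-q≡d q d ⟩
      d               ∎)
    (begin
      ℚ.- (p ℚ.- q)   ≡⟨ -[p-q]≡q-p p q ⟩
      q ℚ.- p         ≤⟨ ℚ.+-monoˡ-≤ (ℚ.- p) q≤p+d ⟩
      p ℚ.+ d ℚ.- p   ≡⟨ [q+d]-q≡d p d ⟩
      d               ∎)

Eventually : Pred ℕ 0ℓ → Set
Eventually P = ∃ λ N → ∀ n → N ℕ.≤ n → P n

both : ∀ {P Q : Pred ℕ 0ℓ} → Eventually P → Eventually Q →
       Eventually (λ n → P n × Q n)
both (M , p) (N , q) = M ℕ.⊔ N , λ n le →
  p n (ℕ.m⊔n≤o⇒m≤o M N le) , q n (ℕ.m⊔n≤o⇒n≤o M N le)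

Cauchy : (ℕ → ℚ) → Set
Cauchy x = ∀ ε → 0ℚ ℚ.< ε →
  ∃ λ N → ∀ m n → N ℕ.≤ m → N ℕ.≤ n → ℚ.∣ x m ℚ.- x n ∣ ℚ.≤ ε

record ℝ : Set where
  constructor mkℝ
  field
    seq    : ℕ → ℚ
    cauchy : Cauchy seq

open ℝ public

infix 4 _≃_ _<_ _≤_ _#_

_≃_ : Rel ℝ 0ℓ
x ≃ y = ∀ ε → 0ℚ ℚ.< ε → Eventually λ n → ℚ.∣ seq x n ℚ.- seq y n ∣ ℚ.≤ ε

_<_ : Rel ℝ 0ℓ
x < y = ∃ λ ε → 0ℚ ℚ.< ε × Eventually λ n → seq x n ℚ.+ ε ℚ.≤ seq y n

_≤_ : Rel ℝ 0ℓ
x ≤ y = ∀ ε → 0ℚ ℚ.< ε → Eventually λ n → seq x n ℚ.≤ seq y n ℚ.+ ε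

_#_ : Rel ℝ 0ℓ
x # y = x < y ⊎ y < x

fromℚ : ℚ → ℝ
fromℚ p = mkℝ (λ _ → p) λ ε ε>0 → 0 , λ _ _ _ _ →
  ℚ.≤-trans (ℚ.≤-reflexive (cong ℚ.∣_∣ (ℚ.+-inverseʳ p))) (ℚ.<⇒≤ ε>0)

fromℕ : ℕ → ℝ
fromℕ n = fromℚ (+ n ℚ./ 1)

0ℝ 1ℝ : ℝ
0ℝ = fromℚ 0ℚ
1ℝ = fromℚ 1ℚ

infixl 6 _-_
infixl 7 _*_

_-_ : ℝ → ℝ → ℝ
seq    (x - y) n = seq x n ℚ.- seq y n
cauchy (x - y) ε ε>0 with cauchy x (ε/2 ε) (ε/2-pos ε>0)
                        | cauchy y (ε/2 ε) (ε/2-pos ε>0)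
... | M , cx | N , cy = M ℕ.⊔ N , λ m n le₁ le₂ →
  let M≤ : ∀ {k} → M ℕ.⊔ N ℕ.≤ k → M ℕ.≤ k
      M≤ = ℕ.m⊔n≤o⇒m≤o M N
      N≤ : ∀ {k} → M ℕ.⊔ N ℕ.≤ k → N ℕ.≤ k
      N≤ = ℕ.m⊔n≤o⇒n≤o M N
      a = seq x m ; b = seq x n ; c = seq y m ; d = seq y n
  in begin
    ℚ.∣ (a ℚ.- c) ℚ.- (b ℚ.- d) ∣
      ≡⟨ cong ℚ.∣_∣ ([p-q]-[r-s]≡[p-r]-[q-s] a c b d) ⟩
    ℚ.∣ (a ℚ.- b) ℚ.- (c ℚ.- d) ∣
      ≤⟨ ℚ.∣p-q∣≤∣p∣+∣q∣ (a ℚ.- b) (c ℚ.- d) ⟩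
    ℚ.∣ a ℚ.- b ∣ ℚ.+ ℚ.∣ c ℚ.- d ∣
      ≤⟨ ℚ.+-mono-≤ (cx m n (M≤ le₁) (M≤ le₂)) (cy m n (N≤ le₁) (N≤ le₂)) ⟩
    ε/2 ε ℚ.+ ε/2 ε
      ≡⟨ ε/2+ε/2 ε ⟩
    ε ∎
  where
  open ℚ.≤-Reasoning

∣_∣ : ℝ → ℝ
seq    ∣ x ∣ n = ℚ.∣ seq x n ∣
cauchy ∣ x ∣ ε ε>0 with cauchy x ε ε>0
... | N , c = N , λ m n le₁ le₂ → ∣p-q∣≤d
  (ℚ.≤-trans (∣p∣≤∣q∣+∣p-q∣ (seq x m) (seq x n))
             (ℚ.+-monoʳ-≤ ℚ.∣ seq x n ∣ (c m n le₁ le₂)))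
  (ℚ.≤-trans (∣p∣≤∣q∣+∣p-q∣ (seq x n) (seq x m))
             (ℚ.+-monoʳ-≤ ℚ.∣ seq x m ∣ (c n m le₂ le₁)))

-- A common precision δ for the factors of a product, given bounds K and L.
split-ε : ∀ {K L ε} → 0ℚ ℚ.< K → 0ℚ ℚ.< L → 0ℚ ℚ.< ε →
          ∃ λ δ → 0ℚ ℚ.< δ × K ℚ.* δ ℚ.+ δ ℚ.* L ≡ ε
split-ε {K} {L} {ε} K>0 L>0 ε>0 = ε ℚ.* i , *-pos-ℚ ε>0 i>0 , eq
  where
  K+L-pos : ℚ.Positive (K ℚ.+ L)
  K+L-pos = ℚ.positive (ℚ.+-mono-< K>0 L>0)

  i : ℚ
  i = (ℚ.1/ (K ℚ.+ L)) {{ℚ.pos⇒nonZero (K ℚ.+ L) {{K+L-pos}}}}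

  i>0 : 0ℚ ℚ.< i
  i>0 = ℚ.positive⁻¹ i {{ℚ.1/pos⇒pos (K ℚ.+ L) {{K+L-pos}}}}

  eq : K ℚ.* (ε ℚ.* i) ℚ.+ ε ℚ.* i ℚ.* L ≡ ε
  eq = ≡.trans (k[ei]+[ei]l≡e[[k+l]i] K L ε i)
    (≡.trans
      (cong (ε ℚ.*_)
        (ℚ.*-inverseʳ (K ℚ.+ L) {{ℚ.pos⇒nonZero (K ℚ.+ L) {{K+L-pos}}}}))
      (ℚ.*-identityʳ ε))

*-close : ∀ p q r s {K L δ} → 0ℚ ℚ.≤ L → 0ℚ ℚ.≤ δ →
          ℚ.∣ p ∣ ℚ.≤ K → ℚ.∣ s ∣ ℚ.≤ L →
          ℚ.∣ p ℚ.- q ∣ ℚ.≤ δ → ℚ.∣ r ℚ.- s ∣ ℚ.≤ δ →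
          ℚ.∣ p ℚ.* r ℚ.- q ℚ.* s ∣ ℚ.≤ K ℚ.* δ ℚ.+ δ ℚ.* L
*-close p q r s {K} {L} {δ} L≥0 δ≥0 p≤K s≤L pq rs = begin
  ℚ.∣ p ℚ.* r ℚ.- q ℚ.* s ∣
    ≡⟨ cong ℚ.∣_∣ (pr-qs≡p[r-s]+[p-q]s p q r s) ⟩
  ℚ.∣ p ℚ.* (r ℚ.- s) ℚ.+ (p ℚ.- q) ℚ.* s ∣
    ≤⟨ ℚ.∣p+q∣≤∣p∣+∣q∣ (p ℚ.* (r ℚ.- s)) ((p ℚ.- q) ℚ.* s) ⟩
  ℚ.∣ p ℚ.* (r ℚ.- s) ∣ ℚ.+ ℚ.∣ (p ℚ.- q) ℚ.* s ∣
    ≡⟨ cong₂ ℚ._+_ (ℚ.∣p*q∣≡∣p∣*∣q∣ p (r ℚ.- s)) (ℚ.∣p*q∣≡∣p∣*∣q∣ (p ℚ.- q) s) ⟩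
  ℚ.∣ p ∣ ℚ.* ℚ.∣ r ℚ.- s ∣ ℚ.+ ℚ.∣ p ℚ.- q ∣ ℚ.* ℚ.∣ s ∣
    ≤⟨ ℚ.+-mono-≤ (*-mono-ℚ (ℚ.0≤∣p∣ p) δ≥0 p≤K rs)
                  (*-mono-ℚ (ℚ.0≤∣p∣ (p ℚ.- q)) L≥0 pq s≤L) ⟩
  K ℚ.* δ ℚ.+ δ ℚ.* L ∎
  where open ℚ.≤-Reasoning

bounded : ∀ x → ∃ λ K → 0ℚ ℚ.< K × Eventually λ n → ℚ.∣ seq x n ∣ ℚ.≤ K
bounded x with cauchy x 1ℚ (ℚ.positive⁻¹ 1ℚ)
... | N , c = ℚ.∣ seq x N ∣ ℚ.+ 1ℚ
            , ℚ.+-mono-≤-< (ℚ.0≤∣p∣ (seq x N)) (ℚ.positive⁻¹ 1ℚ)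
            , N , λ n N≤n → ℚ.≤-trans
                (∣p∣≤∣q∣+∣p-q∣ (seq x n) (seq x N))
                (ℚ.+-monoʳ-≤ ℚ.∣ seq x N ∣ (c n N N≤n ℕ.≤-refl))

cauchy-* : ∀ (x y : ℕ → ℚ) {K L δ ε} → 0ℚ ℚ.< L → 0ℚ ℚ.< δ →
           K ℚ.* δ ℚ.+ δ ℚ.* L ≡ ε →
           Eventually (λ n → ℚ.∣ x n ∣ ℚ.≤ K) →
           Eventually (λ n → ℚ.∣ y n ∣ ℚ.≤ L) →
           (∃ λ N → ∀ m n → N ℕ.≤ m → N ℕ.≤ n → ℚ.∣ x m ℚ.- x n ∣ ℚ.≤ δ) →
           (∃ λ N → ∀ m n → N ℕ.≤ m → N ℕ.≤ n → ℚ.∣ y m ℚ.- y n ∣ ℚ.≤ δ) →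
           ∃ λ N → ∀ m n → N ℕ.≤ m → N ℕ.≤ n →
             ℚ.∣ x m ℚ.* y m ℚ.- x n ℚ.* y n ∣ ℚ.≤ ε
cauchy-* x y L>0 δ>0 refl (M , bx) (N , by) (P , cx) (Q , cy) = R , λ m n le₁ le₂ →
  *-close (x m) (x n) (y m) (y n) (ℚ.<⇒≤ L>0) (ℚ.<⇒≤ δ>0)
    (bx m (M≤ le₁)) (by n (N≤ le₂))
    (cx m n (P≤ le₁) (P≤ le₂)) (cy m n (Q≤ le₁) (Q≤ le₂))
  where
  R : ℕ
  R = (M ℕ.⊔ N) ℕ.⊔ (P ℕ.⊔ Q)

  MN≤ : ∀ {k} → R ℕ.≤ k → M ℕ.⊔ N ℕ.≤ k
  MN≤ = ℕ.m⊔n≤o⇒m≤o (M ℕ.⊔ N) (P ℕ.⊔ Q)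

  PQ≤ : ∀ {k} → R ℕ.≤ k → P ℕ.⊔ Q ℕ.≤ k
  PQ≤ = ℕ.m⊔n≤o⇒n≤o (M ℕ.⊔ N) (P ℕ.⊔ Q)

  M≤ : ∀ {k} → R ℕ.≤ k → M ℕ.≤ k
  M≤ le = ℕ.m⊔n≤o⇒m≤o M N (MN≤ le)

  N≤ : ∀ {k} → R ℕ.≤ k → N ℕ.≤ k
  N≤ le = ℕ.m⊔n≤o⇒n≤o M N (MN≤ le)

  P≤ : ∀ {k} → R ℕ.≤ k → P ℕ.≤ k
  P≤ le = ℕ.m⊔n≤o⇒m≤o P Q (PQ≤ le)

  Q≤ : ∀ {k} → R ℕ.≤ k → Q ℕ.≤ k
  Q≤ le = ℕ.m⊔n≤o⇒n≤o P Q (PQ≤ le)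

_*_ : ℝ → ℝ → ℝ
seq    (x * y) n = seq x n ℚ.* seq y n
cauchy (x * y) ε ε>0 =
  let K , K>0 , bx = bounded x
      L , L>0 , by = bounded y
      δ , δ>0 , eq = split-ε K>0 L>0 ε>0
  in cauchy-* (seq x) (seq y) L>0 δ>0 eq bx by (cauchy x δ δ>0) (cauchy y δ δ>0)

*-pos : ∀ {x y} → 0ℝ < x → 0ℝ < y → 0ℝ < x * y
*-pos {x} {y} (ε , ε>0 , ex) (δ , δ>0 , ey) with both ex ey
... | N , e = ε ℚ.* δ , *-pos-ℚ ε>0 δ>0 , N , λ n le →
  subst (ℚ._≤ seq x n ℚ.* seq y n) (≡.sym (ℚ.+-identityˡ (ε ℚ.* δ)))
    (*-mono-ℚ (ℚ.<⇒≤ ε>0)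
      (ℚ.≤-trans (ℚ.<⇒≤ δ>0) (δ≤ n le))
      (subst (ℚ._≤ seq x n) (ℚ.+-identityˡ ε) (proj₁ (e n le)))
      (δ≤ n le))
  where
  δ≤ : ∀ n → N ℕ.≤ n → δ ℚ.≤ seq y n
  δ≤ n le = subst (ℚ._≤ seq y n) (ℚ.+-identityˡ δ) (proj₂ (e n le))

fromℕ-pos : ∀ n .{{_ : NonZero n}} → 0ℝ < fromℕ n
fromℕ-pos n = + n ℚ./ 1 , ℚ.positive⁻¹ _ {{ℚ.normalize-pos n 1}} , 0 , λ _ _ →
  ℚ.≤-reflexive (ℚ.+-identityˡ (+ n ℚ./ 1))

inv : ∀ p → 0ℚ ℚ.< p → ℚ
inv p p>0 = (ℚ.1/ p) {{ℚ.>-nonZero p>0}}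

inv>0 : ∀ p (p>0 : 0ℚ ℚ.< p) → 0ℚ ℚ.< inv p p>0
inv>0 p p>0 = ℚ.positive⁻¹ _ {{ℚ.1/pos⇒pos p {{ℚ.positive p>0}}}}

p*inv : ∀ p (p>0 : 0ℚ ℚ.< p) → p ℚ.* inv p p>0 ≡ 1ℚ
p*inv p p>0 = ℚ.*-inverseʳ p {{ℚ.>-nonZero p>0}}

module _ where
  open ℚ.≤-Reasoning

  inv-antimono : ∀ {p q i j} → p ℚ.* i ≡ 1ℚ → q ℚ.* j ≡ 1ℚ →
                 0ℚ ℚ.≤ i → 0ℚ ℚ.≤ j → p ℚ.≤ q → j ℚ.≤ i
  inv-antimono {p} {q} {i} {j} pi qj i≥0 j≥0 p≤q = begin
    j                ≡⟨ ℚ.*-identityˡ j ⟨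
    1ℚ ℚ.* j         ≡⟨ cong (ℚ._* j) pi ⟨
    p ℚ.* i ℚ.* j    ≤⟨ ℚ.*-monoʳ-≤-nonNeg j {{ℚ.nonNegative j≥0}}
                          (ℚ.*-monoʳ-≤-nonNeg i {{ℚ.nonNegative i≥0}} p≤q) ⟩
    q ℚ.* i ℚ.* j    ≡⟨ pqr≡q[pr] q i j ⟩
    i ℚ.* (q ℚ.* j)  ≡⟨ cong (i ℚ.*_) qj ⟩
    i ℚ.* 1ℚ         ≡⟨ ℚ.*-identityʳ i ⟩
    i                ∎

  inv-close : ∀ {a b i j s r ε} → a ℚ.* i ≡ 1ℚ → b ℚ.* j ≡ 1ℚ → s ℚ.* r ≡ 1ℚ →
              0ℚ ℚ.≤ i → 0ℚ ℚ.≤ j → 0ℚ ℚ.≤ r → i ℚ.≤ r → j ℚ.≤ r →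
              ℚ.∣ a ℚ.- b ∣ ℚ.≤ ε ℚ.* (s ℚ.* s) → ℚ.∣ i ℚ.- j ∣ ℚ.≤ ε
  inv-close {a} {b} {i} {j} {s} {r} {ε} ai bj sr i≥0 j≥0 r≥0 i≤r j≤r ab = begin
    ℚ.∣ i ℚ.- j ∣
      ≡⟨ cong ℚ.∣_∣ (cong₂ ℚ._-_ (ℚ.*-identityʳ i) (ℚ.*-identityʳ j)) ⟨
    ℚ.∣ i ℚ.* 1ℚ ℚ.- j ℚ.* 1ℚ ∣
      ≡⟨ cong ℚ.∣_∣ (cong₂ (λ y z → i ℚ.* y ℚ.- j ℚ.* z) bj ai) ⟨
    ℚ.∣ i ℚ.* (b ℚ.* j) ℚ.- j ℚ.* (a ℚ.* i) ∣
      ≡⟨ cong ℚ.∣_∣ (i[bj]-j[ai]≡[b-a][ij] a b i j) ⟩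
    ℚ.∣ (b ℚ.- a) ℚ.* (i ℚ.* j) ∣
      ≡⟨ ℚ.∣p*q∣≡∣p∣*∣q∣ (b ℚ.- a) (i ℚ.* j) ⟩
    ℚ.∣ b ℚ.- a ∣ ℚ.* ℚ.∣ i ℚ.* j ∣
      ≡⟨ cong₂ ℚ._*_ (∣p-q∣≡∣q-p∣ b a) (ℚ.0≤p⇒∣p∣≡p (*-nonNeg i≥0 j≥0)) ⟩
    ℚ.∣ a ℚ.- b ∣ ℚ.* (i ℚ.* j)
      ≤⟨ *-mono-ℚ (ℚ.0≤∣p∣ (a ℚ.- b)) (*-nonNeg r≥0 r≥0) ab
           (*-mono-ℚ i≥0 r≥0 i≤r j≤r) ⟩
    ε ℚ.* (s ℚ.* s) ℚ.* (r ℚ.* r)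
      ≡⟨ e[ss][rr]≡e[[sr][sr]] ε s r ⟩
    ε ℚ.* ((s ℚ.* r) ℚ.* (s ℚ.* r))
      ≡⟨ cong (λ z → ε ℚ.* (z ℚ.* z)) sr ⟩
    ε ℚ.* (1ℚ ℚ.* 1ℚ)
      ≡⟨ ℚ.*-identityʳ ε ⟩
    ε ∎
    where
    *-nonNeg : ∀ {p q} → 0ℚ ℚ.≤ p → 0ℚ ℚ.≤ q → 0ℚ ℚ.≤ p ℚ.* q
    *-nonNeg {p} {q} p≥0 q≥0 = subst (ℚ._≤ p ℚ.* q) (ℚ.*-zeroˡ q)
      (ℚ.*-monoʳ-≤-nonNeg q {{ℚ.nonNegative q≥0}} p≥0)

-- A positivity proof supplies ε₀ > 0 with ε₀ ≤ xₙ for all large n. Replacing xₙ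
-- by xₙ ⊔ ε₀ keeps every term away from 0 and changes only finitely many terms.
1/[_] : (x : ℝ) → 0ℝ < x → ℝ
1/[ x ] (ε₀ , ε₀>0 , N₀ , ε₀≤x) = mkℝ (λ n → inv (a n) (a>0 n)) cauchy-inv
  where
  a : ℕ → ℚ
  a n = seq x n ℚ.⊔ ε₀

  ε₀≤a : ∀ n → ε₀ ℚ.≤ a n
  ε₀≤a n = ℚ.p≤q⊔p (seq x n) ε₀

  a>0 : ∀ n → 0ℚ ℚ.< a n
  a>0 n = ℚ.<-≤-trans ε₀>0 (ε₀≤a n)

  a≡x : ∀ n → N₀ ℕ.≤ n → a n ≡ seq x n
  a≡x n le = ℚ.p≥q⇒p⊔q≡p (subst (ℚ._≤ seq x n) (ℚ.+-identityˡ ε₀) (ε₀≤x n le))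

  inv≥0 : ∀ p (p>0 : 0ℚ ℚ.< p) → 0ℚ ℚ.≤ inv p p>0
  inv≥0 p p>0 = ℚ.<⇒≤ (inv>0 p p>0)

  inv≤ : ∀ n → inv (a n) (a>0 n) ℚ.≤ inv ε₀ ε₀>0
  inv≤ n = inv-antimono (p*inv ε₀ ε₀>0) (p*inv (a n) (a>0 n))
    (inv≥0 ε₀ ε₀>0) (inv≥0 (a n) (a>0 n)) (ε₀≤a n)

  close : ∀ ε m n → N₀ ℕ.≤ m → N₀ ℕ.≤ n →
          ℚ.∣ seq x m ℚ.- seq x n ∣ ℚ.≤ ε ℚ.* (ε₀ ℚ.* ε₀) →
          ℚ.∣ inv (a m) (a>0 m) ℚ.- inv (a n) (a>0 n) ∣ ℚ.≤ ε
  close ε m n le₁ le₂ xmn = inv-close {a m} {a n} {s = ε₀}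
    (p*inv (a m) (a>0 m)) (p*inv (a n) (a>0 n)) (p*inv ε₀ ε₀>0)
    (inv≥0 (a m) (a>0 m)) (inv≥0 (a n) (a>0 n)) (inv≥0 ε₀ ε₀>0)
    (inv≤ m) (inv≤ n)
    (≡.subst₂ (λ y z → ℚ.∣ y ℚ.- z ∣ ℚ.≤ ε ℚ.* (ε₀ ℚ.* ε₀))
      (≡.sym (a≡x m le₁)) (≡.sym (a≡x n le₂)) xmn)

  cauchy-inv : Cauchy (λ n → inv (a n) (a>0 n))
  cauchy-inv ε ε>0 =
    let N , c = cauchy x (ε ℚ.* (ε₀ ℚ.* ε₀)) (*-pos-ℚ ε>0 (*-pos-ℚ ε₀>0 ε₀>0))
    in N ℕ.⊔ N₀ , λ m n le₁ le₂ → close ε m n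
         (ℕ.m⊔n≤o⇒n≤o N N₀ le₁) (ℕ.m⊔n≤o⇒n≤o N N₀ le₂)
         (c m n (ℕ.m⊔n≤o⇒m≤o N N₀ le₁) (ℕ.m⊔n≤o⇒m≤o N N₀ le₂))

fromℤ : ℤ → ℚ
fromℤ k = k ℚ./ 1

‖_‖ℚ : ℚ → ℚ
‖ p ‖ℚ = ℚ.∣ p ℚ.- fromℤ (ℚ.round p) ∣

-- k ↦ k / 1 reduces better in this form.
toℚ : ℤ → ℚ
toℚ k = mkℚ k 0 (sym (1-coprimeTo _))

fromℤ≡toℚ : ∀ k → fromℤ k ≡ toℚ k
fromℤ≡toℚ k = ℚ.↥p/↧p≡p (toℚ k)

fromℤ-mono-≤ : ∀ {k l} → k ℤ.≤ l → fromℤ k ℚ.≤ fromℤ l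
fromℤ-mono-≤ {k} {l} k≤l = ≡.subst₂ ℚ._≤_
  (≡.sym (fromℤ≡toℚ k)) (≡.sym (fromℤ≡toℚ l))
  (ℚ.*≤* (ℤ.*-monoʳ-≤-nonNeg (+ 1) k≤l))

fromℤ-+1 : ∀ k → fromℤ (ℤ.suc k) ≡ 1ℚ ℚ.+ fromℤ k
fromℤ-+1 k = ≡.trans (cong (λ z → (+ 1 ℤ.+ z) ℚ./ 1) (≡.sym (ℤ.*-identityʳ k)))
  (cong (1ℚ ℚ.+_) (≡.sym (fromℤ≡toℚ k)))

fromℤ-neg : ∀ k → fromℤ (ℤ.- k) ≡ ℚ.- fromℤ k
fromℤ-neg k = ≡.trans (fromℤ≡toℚ (ℤ.- k)) (≡.trans (lemma k) (cong ℚ.-_ (≡.sym (fromℤ≡toℚ k))))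
  where
  lemma : ∀ k → toℚ (ℤ.- k) ≡ ℚ.- toℚ k
  lemma (+ 0)         = refl
  lemma ℤ.+[1+ _ ]    = refl
  lemma -[1+ _ ]      = refl

floor-≤ : ∀ p → fromℤ (ℚ.floor p) ℚ.≤ p
floor-≤ p@record{} = subst (ℚ._≤ p) (≡.sym (fromℤ≡toℚ (ℚ.floor p)))
  (ℚ.*≤* (subst (ℚ.floor p ℤ.* ℚ.↧ p ℤ.≤_) (≡.sym (ℤ.*-identityʳ (ℚ.↥ p)))
    (ℤ.[n/d]*d≤n (ℚ.↥ p) (ℚ.↧ p))))

<-floor+1 : ∀ p → p ℚ.< 1ℚ ℚ.+ fromℤ (ℚ.floor p)
<-floor+1 p@record{} = subst (p ℚ.<_) (fromℤ-+1 (ℚ.floor p))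
  (subst (p ℚ.<_) (≡.sym (fromℤ≡toℚ (ℤ.suc (ℚ.floor p))))
    (ℚ.*<* (≡.subst₂ ℤ._<_ (≡.sym (ℤ.*-identityʳ (ℚ.↥ p)))
      (cong (λ z → ℤ.suc z ℤ.* ℚ.↧ p) (≡.sym (ℤ.div-pos-is-/ℕ (ℚ.↥ p) (ℚ.↧ₙ p))))
      (ℤ.n<s[n/ℕd]*d (ℚ.↥ p) (ℚ.↧ₙ p)))))

module _ where
  open +-*-Solver
  open ℚ.≤-Reasoning

  p≡[p+½]-½ : ∀ p → p ≡ p ℚ.+ ½ ℚ.- ½
  p≡[p+½]-½ p = solve 1 (λ p → p := p :+ con ½ :- con ½) refl p

  [1+f]-½≡f+½ : ∀ f → 1ℚ ℚ.+ f ℚ.- ½ ≡ f ℚ.+ ½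
  [1+f]-½≡f+½ f = solve 1 (λ f → con 1ℚ :+ f :- con ½ := f :+ con ½) refl f

  p≡-[-[p-½]]+½ : ∀ p → p ≡ ℚ.- (ℚ.- (p ℚ.- ½)) ℚ.+ ½
  p≡-[-[p-½]]+½ p = solve 1 (λ p → p := :- (:- (p :- con ½)) :+ con ½) refl p

  -f≡-[1+f]+1 : ∀ f → ℚ.- f ≡ ℚ.- (1ℚ ℚ.+ f) ℚ.+ 1ℚ
  -f≡-[1+f]+1 f = solve 1 (λ f → :- f := :- (con 1ℚ :+ f) :+ con 1ℚ) refl f

  -[-[p-½]]+1≡p+½ : ∀ p → ℚ.- (ℚ.- (p ℚ.- ½)) ℚ.+ 1ℚ ≡ p ℚ.+ ½
  -[-[p-½]]+1≡p+½ p =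
    solve 1 (λ p → :- (:- (p :- con ½)) :+ con 1ℚ := p :+ con ½) refl p

  ½≡[1+k]-k-½ : ∀ k → ½ ≡ 1ℚ ℚ.+ k ℚ.- k ℚ.- ½
  ½≡[1+k]-k-½ k = solve 1 (λ k → con ½ := con 1ℚ :+ k :- k :- con ½) refl k

  [p+½]-k-½≡p-k : ∀ p k → p ℚ.+ ½ ℚ.- k ℚ.- ½ ≡ p ℚ.- k
  [p+½]-k-½≡p-k p k =
    solve 2 (λ p k → p :+ con ½ :- k :- con ½ := p :- k) refl p k

  1+k≤p+½⇒½≤∣p-k∣ : ∀ p k → 1ℚ ℚ.+ k ℚ.≤ p ℚ.+ ½ → ½ ℚ.≤ ℚ.∣ p ℚ.- k ∣
  1+k≤p+½⇒½≤∣p-k∣ p k le = begin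
    ½                        ≡⟨ ½≡[1+k]-k-½ k ⟩
    1ℚ ℚ.+ k ℚ.- k ℚ.- ½     ≤⟨ ℚ.+-monoˡ-≤ (ℚ.- ½) (ℚ.+-monoˡ-≤ (ℚ.- k) le) ⟩
    p ℚ.+ ½ ℚ.- k ℚ.- ½      ≡⟨ [p+½]-k-½≡p-k p k ⟩
    p ℚ.- k                  ≤⟨ p≤∣p∣ (p ℚ.- k) ⟩
    ℚ.∣ p ℚ.- k ∣            ∎
    where
    p≤∣p∣ : ∀ p → p ℚ.≤ ℚ.∣ p ∣
    p≤∣p∣ p with ℚ.≤-total 0ℚ p
    ... | inj₁ 0≤p = ℚ.≤-reflexive (≡.sym (ℚ.0≤p⇒∣p∣≡p 0≤p))
    ... | inj₂ p≤0 = ℚ.≤-trans p≤0 (ℚ.0≤∣p∣ p)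

  floor-near : ∀ p → let k = fromℤ (ℚ.floor (p ℚ.+ ½)) in
               p ℚ.≤ k ℚ.+ ½ × k ℚ.≤ p ℚ.+ ½
  floor-near p = (let k = fromℤ (ℚ.floor (p ℚ.+ ½)) in begin
    p                   ≡⟨ p≡[p+½]-½ p ⟩
    p ℚ.+ ½ ℚ.- ½       ≤⟨ ℚ.+-monoˡ-≤ (ℚ.- ½) (ℚ.<⇒≤ (<-floor+1 (p ℚ.+ ½))) ⟩
    1ℚ ℚ.+ k ℚ.- ½      ≡⟨ [1+f]-½≡f+½ k ⟩
    k ℚ.+ ½             ∎) , floor-≤ (p ℚ.+ ½)

  ceiling-neg : ∀ p → fromℤ (ℚ.ceiling p) ≡ ℚ.- fromℤ (ℚ.floor (ℚ.- p))
  ceiling-neg p@record{} = fromℤ-neg (ℚ.floor (ℚ.- p))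

  ceiling-near : ∀ p → let k = fromℤ (ℚ.ceiling (p ℚ.- ½)) in
                 p ℚ.≤ k ℚ.+ ½ × k ℚ.≤ p ℚ.+ ½
  ceiling-near p = subst (λ k → p ℚ.≤ k ℚ.+ ½ × k ℚ.≤ p ℚ.+ ½)
    (≡.sym (ceiling-neg (p ℚ.- ½)))
    ( (begin
        p                             ≡⟨ p≡-[-[p-½]]+½ p ⟩
        ℚ.- (ℚ.- (p ℚ.- ½)) ℚ.+ ½     ≤⟨ ℚ.+-monoˡ-≤ ½ (ℚ.neg-antimono-≤ (floor-≤ (ℚ.- (p ℚ.- ½)))) ⟩
        ℚ.- f ℚ.+ ½                   ∎)
    , (begin
        ℚ.- f                         ≡⟨ -f≡-[1+f]+1 f ⟩
        ℚ.- (1ℚ ℚ.+ f) ℚ.+ 1ℚ         ≤⟨ ℚ.+-monoˡ-≤ 1ℚ (ℚ.neg-antimono-≤ (ℚ.<⇒≤ (<-floor+1 (ℚ.- (p ℚ.- ½))))) ⟩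
        ℚ.- (ℚ.- (p ℚ.- ½)) ℚ.+ 1ℚ    ≡⟨ -[-[p-½]]+1≡p+½ p ⟩
        p ℚ.+ ½                       ∎))
    where
    f : ℚ
    f = fromℤ (ℚ.floor (ℚ.- (p ℚ.- ½)))

  round-near : ∀ p → let k = fromℤ (ℚ.round p) in
               p ℚ.≤ k ℚ.+ ½ × k ℚ.≤ p ℚ.+ ½
  round-near p with p ℚ.≤ᵇ 0ℚ
  ... | true  = ceiling-near p
  ... | false = floor-near p

  ‖p‖≤∣p-k∣ : ∀ p k → ‖ p ‖ℚ ℚ.≤ ℚ.∣ p ℚ.- fromℤ k ∣
  ‖p‖≤∣p-k∣ p k = [ <-case , [ ≡-case , >-case ]′ ]′ (compare k (ℚ.round p))
    where
    r : ℚ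
    r = fromℤ (ℚ.round p)

    ‖p‖≤½ : ‖ p ‖ℚ ℚ.≤ ½
    ‖p‖≤½ = ∣p-q∣≤d (proj₁ (round-near p)) (proj₂ (round-near p))

    compare : ∀ k l → k ℤ.< l ⊎ k ≡ l ⊎ l ℤ.< k
    compare k l with ℤ.<-cmp k l
    ... | tri< k<l _ _ = inj₁ k<l
    ... | tri≈ _ k≡l _ = inj₂ (inj₁ k≡l)
    ... | tri> _ _ l<k = inj₂ (inj₂ l<k)

    1+-≤ : ∀ {k l} → k ℤ.< l → 1ℚ ℚ.+ fromℤ k ℚ.≤ fromℤ l
    1+-≤ {k} {l} k<l = subst (ℚ._≤ fromℤ l) (fromℤ-+1 k)
      (fromℤ-mono-≤ (ℤ.i<j⇒suc[i]≤j k<l))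

    <-case : k ℤ.< ℚ.round p → ‖ p ‖ℚ ℚ.≤ ℚ.∣ p ℚ.- fromℤ k ∣
    <-case k<r = ℚ.≤-trans ‖p‖≤½ (1+k≤p+½⇒½≤∣p-k∣ p (fromℤ k)
      (ℚ.≤-trans (1+-≤ k<r) (proj₂ (round-near p))))

    ≡-case : k ≡ ℚ.round p → ‖ p ‖ℚ ℚ.≤ ℚ.∣ p ℚ.- fromℤ k ∣
    ≡-case k≡r = ℚ.≤-reflexive
      (cong (λ k → ℚ.∣ p ℚ.- fromℤ k ∣) (≡.sym k≡r))

    >-case : ℚ.round p ℤ.< k → ‖ p ‖ℚ ℚ.≤ ℚ.∣ p ℚ.- fromℤ k ∣
    >-case r<k = begin
      ‖ p ‖ℚ                 ≤⟨ ‖p‖≤½ ⟩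
      ½                      ≤⟨ 1+k≤p+½⇒½≤∣p-k∣ (fromℤ k) p 1+p≤k+½ ⟩
      ℚ.∣ fromℤ k ℚ.- p ∣    ≡⟨ ∣p-q∣≡∣q-p∣ (fromℤ k) p ⟩
      ℚ.∣ p ℚ.- fromℤ k ∣    ∎
      where
      1+p≤k+½ : 1ℚ ℚ.+ p ℚ.≤ fromℤ k ℚ.+ ½
      1+p≤k+½ = begin
        1ℚ ℚ.+ p           ≤⟨ ℚ.+-monoʳ-≤ 1ℚ (proj₁ (round-near p)) ⟩
        1ℚ ℚ.+ (r ℚ.+ ½)   ≡⟨ ℚ.+-assoc 1ℚ r ½ ⟨
        1ℚ ℚ.+ r ℚ.+ ½     ≤⟨ ℚ.+-monoˡ-≤ ½ (1+-≤ r<k) ⟩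
        fromℤ k ℚ.+ ½      ∎

  ‖-‖-nonexpansive : ∀ p q → ℚ.∣ ‖ p ‖ℚ ℚ.- ‖ q ‖ℚ ∣ ℚ.≤ ℚ.∣ p ℚ.- q ∣
  ‖-‖-nonexpansive p q = ∣p-q∣≤d (step p q)
    (subst (λ d → ‖ q ‖ℚ ℚ.≤ ‖ p ‖ℚ ℚ.+ d) (∣p-q∣≡∣q-p∣ q p) (step q p))
    where
    step : ∀ p q → ‖ p ‖ℚ ℚ.≤ ‖ q ‖ℚ ℚ.+ ℚ.∣ p ℚ.- q ∣
    step p q = begin
      ‖ p ‖ℚ                             ≤⟨ ‖p‖≤∣p-k∣ p (ℚ.round q) ⟩
      ℚ.∣ p ℚ.- fromℤ (ℚ.round q) ∣      ≤⟨ ∣p-r∣≤∣p-q∣+∣q-r∣ p q (fromℤ (ℚ.round q)) ⟩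
      ℚ.∣ p ℚ.- q ∣ ℚ.+ ‖ q ‖ℚ           ≡⟨ ℚ.+-comm ℚ.∣ p ℚ.- q ∣ ‖ q ‖ℚ ⟩
      ‖ q ‖ℚ ℚ.+ ℚ.∣ p ℚ.- q ∣           ∎

‖_‖ : ℝ → ℝ
seq    ‖ x ‖ n = ‖ seq x n ‖ℚ
cauchy ‖ x ‖ ε ε>0 =
  let N , c = cauchy x ε ε>0
  in N , λ m n le₁ le₂ → ℚ.≤-trans
       (‖-‖-nonexpansive (seq x m) (seq x n)) (c m n le₁ le₂)

Family : Set
Family = (q : ℕ) → .{{NonZero q}} → ℝ

NonIncreasing : Family → Set
NonIncreasing f = ∀ p q .{{_ : NonZero p}} .{{_ : NonZero q}} → p ℕ.≤ q → f q ≤ f p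

ConvergesTo : Family → ℝ → Set
ConvergesTo f l = ∀ ε → 0ℝ < ε →
  ∃ λ N → ∀ q .{{_ : NonZero q}} → N ℕ.≤ q → ∣ f q - l ∣ < ε

TendsToInfinity : Family → Set
TendsToInfinity f = ∀ K →
  ∃ λ N → ∀ q .{{_ : NonZero q}} → N ℕ.≤ q → K < f q

-- inf f > a. The infimum itself is not required to exist as an element of ℝ,
-- which would be a locatedness condition with no classical counterpart.
Infimum>_ : ℝ → Family → Set
(Infimum> a) f = ∃ λ c → a < c × ∀ q .{{_ : NonZero q}} → c ≤ f q

IsInfimum : Family → ℝ → Set
IsInfimum f i =
  (∀ q .{{_ : NonZero q}} → i ≤ f q) ×
  (∀ y → i < y → ∃ λ q → ∃ λ (q≢0 : NonZero q) → f q {{q≢0}} < y)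

Infinitely : ((q : ℕ) → .{{NonZero q}} → Set) → Set
Infinitely P = ∀ N → ∃ λ q → ∃ λ (q≢0 : NonZero q) → N ℕ.≤ q × P q {{q≢0}}

Bad : Pred ℝ 0ℓ
Bad α = (Infimum> 0ℝ) λ q → fromℕ q * ‖ fromℕ q * α ‖

littlewood : ℝ → ℝ → Family
littlewood α β q = fromℕ q * ‖ fromℕ q * α ‖ * ‖ fromℕ q * β ‖

-- Cantor's form of uncountability: every sequence of reals misses a member of
-- B. It implies that no sequence of reals enumerates B, and is classically
-- equivalent to it.
Uncountable : Pred ℝ 0ℓ → Set
Uncountable B = ∀ (f : ℕ → ℝ) → ∃ λ β → β ∈ B × ∀ n → β # f n

-- A set of continuum many reals cannot be listed, so constructing it means
-- computing its members, and only its members, from binary sequences.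
EffectivelyConstructed : Pred ℝ 0ℓ → Set
EffectivelyConstructed B = ∃ λ (b : (ℕ → Bool) → ℝ) →
  (∀ {s t} → s ≗ t → b s ≃ b t) ×
  (∀ β → β ∈ B ⇔ ∃ λ s → β ≃ b s)

{-# OPTIONS --safe #-}

-- Write q_w for the continuant of a word w. If w is the reversal of the first
-- partial quotients of α and u is any word, the denominator of [0; u, w] is
-- q = den u · q_w + den′ u · q_w′, where q_w and q_w′ are consecutive convergent
-- denominators of α. Hence ‖qα‖ ≤ C(u)/q, while ‖qβ‖ ≤ 1/q for every β whose
-- expansion begins with u, w. Since φ → 0, taking w long makes φ(q) absorb the
-- constant C(u). Alternate such words w with free digits 1 or 3: the free digits
-- encode a binary sequence, and all partial quotients stay bounded.

module Submission where

open import Defs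
open import Data.Bool.Base using (Bool; true; false)
open import Data.Integer.Base as ℤ using (ℤ; +_; -[1+_])
import Data.Integer.DivMod as ℤ
import Data.Integer.Properties as ℤ
open import Data.Integer.Tactic.RingSolver using (solve-∀)
open import Data.List.Base using (List; []; _∷_; _++_; foldr)
open import Data.List.Properties using (++-assoc; ++-identityʳ)
open import Data.List.Relation.Unary.All as All using (All; []; _∷_)
import Data.List.Relation.Unary.All.Properties as All
open import Data.Nat.Base as ℕ using (ℕ; zero; suc; NonZero; z≤n; s≤s)
import Data.Nat.DivMod as ℕ
import Data.Nat.Properties as ℕ
import Data.Nat.Tactic.RingSolver as ℕSolver
open import Data.Product.Base using (∃; ∃₂; _×_; _,_; proj₁; proj₂)
open import Data.Rational.Base as ℚ using (ℚ; 0ℚ; 1ℚ; mkℚ)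
import Data.Rational.Properties as ℚ
open import Data.Rational.Solver using (module +-*-Solver)
import Data.Rational.Unnormalised.Base as ℚᵘ
open import Data.Sum.Base using (_⊎_; inj₁; inj₂)
open import Function.Bundles using (mk⇔)
open import Level using (0ℓ)
open import Relation.Binary.PropositionalEquality as ≡
  using (_≡_; refl; cong; cong₂; subst; sym; trans; _≗_)
open import Relation.Nullary.Decidable.Core using (yes; no)
open import Relation.Unary using (Pred; _∈_; _⊆_)

-- Continuants and convergents

-- The partial quotients of a real given by a Cauchy sequence cannot be read off, since the floor is
-- discontinuous. Each stage therefore fixes one rational term of `α`, precise enough for the
-- denominators in play, and runs Euclid's algorithm on it. Badness of `α` passes to this term for
-- all `q` up to a prescribed size; there it bounds the quotients and keeps the algorithm from
-- stopping early. All estimates thus become integer inequalities between continuants, uniform in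
-- the tail of the word, and so survive the passage to the limit. The order of choices matters: the
-- constant lost at a stage depends only on the prefix `u`, so it is known before the required
-- length of `w` is fixed. Uncountability has to come with apartness witnesses. The two free digits
-- of a stage lead to cylinders whose distance is large against their widths, so a single rational
-- approximation of the real to be avoided tells which digit to take.

-- A letter a of a word stands for the partial quotient suc a.
step : ℕ → ℕ × ℕ → ℕ × ℕ
step a (x , y) = suc a ℕ.* x ℕ.+ y , x

act : List ℕ → ℕ × ℕ → ℕ × ℕ
act []      z = z
act (a ∷ w) z = act w (step a z)

cont : List ℕ → ℕ × ℕ
cont = foldr step (1 , 0)

κ κ′ : List ℕ → ℕ
κ w = proj₁ (cont w)
κ′ w = proj₂ (cont w)

-- Each `step a` is a symmetric matrix, so transposing the product lets the letters act on `(1 , 0)`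
-- in the opposite order. For `z = (1 , 0)` this is the invariance of continuants under reversal.
act-cont : ∀ w z → proj₁ (act w z) ≡ proj₁ z ℕ.* κ w ℕ.+ proj₂ z ℕ.* κ′ w
act-cont []      (x , y) = lemma x y
  where
  lemma : ∀ x y → x ≡ x ℕ.* 1 ℕ.+ y ℕ.* 0
  lemma = ℕSolver.solve-∀
act-cont (a ∷ w) (x , y) = trans (act-cont w (step a (x , y))) (lemma (suc a) x y (κ w) (κ′ w))
  where
  lemma : ∀ a x y q r → (a ℕ.* x ℕ.+ y) ℕ.* q ℕ.+ x ℕ.* r ≡ x ℕ.* (a ℕ.* q ℕ.+ r) ℕ.+ y ℕ.* q
  lemma = ℕSolver.solve-∀

act-++ : ∀ u v z → act (u ++ v) z ≡ act v (act u z)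
act-++ []      v z = refl
act-++ (a ∷ u) v z = act-++ u v (step a z)

step-ordered : ∀ a z → proj₂ (step a z) ℕ.≤ proj₁ (step a z)
step-ordered a (x , y) = ℕ.≤-trans (ℕ.m≤m+n x (a ℕ.* x)) (ℕ.m≤m+n (suc a ℕ.* x) y)

κ′≤κ : ∀ w → κ′ w ℕ.≤ κ w
κ′≤κ []      = z≤n
κ′≤κ (a ∷ w) = step-ordered a (cont w)

κ≥1 : ∀ w → 1 ℕ.≤ κ w
κ≥1 []      = ℕ.≤-refl
κ≥1 (a ∷ w) = ℕ.≤-trans (κ≥1 w) (step-ordered a (cont w))

act-grows : ∀ w z → proj₁ z ℕ.≤ proj₁ (act w z)
act-grows []      z = ℕ.≤-refl
act-grows (a ∷ w) z = ℕ.≤-trans (step-ordered a z) (act-grows w (step a z))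

act-ordered : ∀ w z → proj₂ z ℕ.≤ proj₁ z → proj₂ (act w z) ℕ.≤ proj₁ (act w z)
act-ordered []      z le = le
act-ordered (a ∷ w) z le = act-ordered w (step a z) (step-ordered a z)

-- The seeds encode the convergent 0/1 and its formal predecessor 1/0. Hence `num w / den w` is
-- `[0; w]`, and the primed values belong to the preceding convergent.
num den num′ den′ : List ℕ → ℕ
num  w = proj₁ (act w (0 , 1))
num′ w = proj₂ (act w (0 , 1))
den  w = proj₁ (act w (1 , 0))
den′ w = proj₂ (act w (1 , 0))

den≥1 : ∀ w → 1 ℕ.≤ den w
den≥1 w = act-grows w (1 , 0)

den′≤den : ∀ w → den′ w ℕ.≤ den w
den′≤den w = act-ordered w (1 , 0) z≤n

num-++ : ∀ u v → num (u ++ v) ≡ num u ℕ.* κ v ℕ.+ num′ u ℕ.* κ′ v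
num-++ u v = trans (cong proj₁ (act-++ u v (0 , 1))) (act-cont v (act u (0 , 1)))

den-++ : ∀ u v → den (u ++ v) ≡ den u ℕ.* κ v ℕ.+ den′ u ℕ.* κ′ v
den-++ u v = trans (cong proj₁ (act-++ u v (1 , 0))) (act-cont v (act u (1 , 0)))

pos-linear : ∀ a b c d → + (a ℕ.* b ℕ.+ c ℕ.* d) ≡ + a ℤ.* + b ℤ.+ + c ℤ.* + d
pos-linear a b c d = cong₂ ℤ._+_ (ℤ.pos-* a b) (ℤ.pos-* c d)

det : ℕ × ℕ → ℕ × ℕ → ℤ
det (x , x′) (y , y′) = + x ℤ.* + y′ ℤ.- + x′ ℤ.* + y

det-step : ∀ a z w → det (step a z) (step a w) ≡ ℤ.- det z w
det-step a (x , x′) (y , y′) = trans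
  (cong₂ (λ i j → i ℤ.* + y ℤ.- + x ℤ.* j) (eq x x′) (eq y y′))
  (lemma (+ suc a) (+ x) (+ x′) (+ y) (+ y′))
  where
  eq : ∀ x x′ → + (suc a ℕ.* x ℕ.+ x′) ≡ + suc a ℤ.* + x ℤ.+ + x′
  eq x x′ = cong (ℤ._+ + x′) (ℤ.pos-* (suc a) x)
  lemma : ∀ a x x′ y y′ → (a ℤ.* x ℤ.+ x′) ℤ.* y ℤ.- x ℤ.* (a ℤ.* y ℤ.+ y′) ≡
                          ℤ.- (x ℤ.* y′ ℤ.- x′ ℤ.* y)
  lemma = solve-∀

∣det-act∣ : ∀ w z z′ → ℤ.∣ det (act w z) (act w z′) ∣ ≡ ℤ.∣ det z z′ ∣
∣det-act∣ []      z z′ = refl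
∣det-act∣ (a ∷ w) z z′ = trans (∣det-act∣ w (step a z) (step a z′))
  (trans (cong ℤ.∣_∣ (det-step a z z′)) (ℤ.∣-i∣≡∣i∣ (det z z′)))

∣det∣≡1 : ∀ w → ℤ.∣ det (act w (0 , 1)) (act w (1 , 0)) ∣ ≡ 1
∣det∣≡1 w = ∣det-act∣ w (0 , 1) (1 , 0)

-- Prepending `u` multiplies the pair of tails by a matrix of determinant ±1, so only the
-- determinant of the tails remains.
cross-difference : ∀ u v w →
  ℤ.∣ + num (u ++ v) ℤ.* + den (u ++ w) ℤ.- + num (u ++ w) ℤ.* + den (u ++ v) ∣ ≡
  ℤ.∣ det (cont v) (cont w) ∣
cross-difference u v w = trans (cong ℤ.∣_∣ eq)
  (trans (ℤ.abs-* (det (act u (0 , 1)) (act u (1 , 0))) (det (cont v) (cont w)))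
    (trans (cong (ℕ._* ℤ.∣ det (cont v) (cont w) ∣) (∣det∣≡1 u)) (ℕ.*-identityˡ _)))
  where
  lemma : ∀ p p′ s s′ q r q₁ r₁ →
    (p ℤ.* q ℤ.+ p′ ℤ.* r) ℤ.* (s ℤ.* q₁ ℤ.+ s′ ℤ.* r₁) ℤ.-
    (p ℤ.* q₁ ℤ.+ p′ ℤ.* r₁) ℤ.* (s ℤ.* q ℤ.+ s′ ℤ.* r) ≡
    (p ℤ.* s′ ℤ.- p′ ℤ.* s) ℤ.* (q ℤ.* r₁ ℤ.- r ℤ.* q₁)
  lemma = solve-∀
  N : ∀ v → + num (u ++ v) ≡ + num u ℤ.* + κ v ℤ.+ + num′ u ℤ.* + κ′ v
  N v = trans (cong +_ (num-++ u v)) (pos-linear (num u) (κ v) (num′ u) (κ′ v))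
  D : ∀ v → + den (u ++ v) ≡ + den u ℤ.* + κ v ℤ.+ + den′ u ℤ.* + κ′ v
  D v = trans (cong +_ (den-++ u v)) (pos-linear (den u) (κ v) (den′ u) (κ′ v))
  eq : + num (u ++ v) ℤ.* + den (u ++ w) ℤ.- + num (u ++ w) ℤ.* + den (u ++ v) ≡
       det (act u (0 , 1)) (act u (1 , 0)) ℤ.* det (cont v) (cont w)
  eq = trans (cong₂ ℤ._-_ (cong₂ ℤ._*_ (N v) (D w)) (cong₂ ℤ._*_ (N w) (D v)))
    (lemma (+ num u) (+ num′ u) (+ den u) (+ den′ u) (+ κ v) (+ κ′ v) (+ κ w) (+ κ′ w))

∣den*num-num*den∣ : ∀ u v →
  ℤ.∣ + den u ℤ.* + num (u ++ v) ℤ.- + num u ℤ.* + den (u ++ v) ∣ ≡ κ′ v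
∣den*num-num*den∣ u v = trans (cong ℤ.∣_∣ eq)
  (trans (cong ℤ.∣_∣ (lemma (+ num u) (+ num′ u) (+ den u) (+ den′ u) (+ κ v) (+ κ′ v)))
  (trans (ℤ.∣-i∣≡∣i∣ (d ℤ.* + κ′ v)) (trans (ℤ.abs-* d (+ κ′ v))
    (trans (cong (ℕ._* κ′ v) (∣det∣≡1 u)) (ℕ.*-identityˡ _)))))
  where
  d : ℤ
  d = det (act u (0 , 1)) (act u (1 , 0))
  lemma : ∀ p p′ s s′ q r →
    s ℤ.* (p ℤ.* q ℤ.+ p′ ℤ.* r) ℤ.- p ℤ.* (s ℤ.* q ℤ.+ s′ ℤ.* r) ≡
    ℤ.- ((p ℤ.* s′ ℤ.- p′ ℤ.* s) ℤ.* r)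
  lemma = solve-∀
  eq : + den u ℤ.* + num (u ++ v) ℤ.- + num u ℤ.* + den (u ++ v) ≡
       + den u ℤ.* (+ num u ℤ.* + κ v ℤ.+ + num′ u ℤ.* + κ′ v) ℤ.-
       + num u ℤ.* (+ den u ℤ.* + κ v ℤ.+ + den′ u ℤ.* + κ′ v)
  eq = cong₂ (λ i j → + den u ℤ.* i ℤ.- + num u ℤ.* j)
    (trans (cong +_ (num-++ u v)) (pos-linear (num u) (κ v) (num′ u) (κ′ v)))
    (trans (cong +_ (den-++ u v)) (pos-linear (den u) (κ v) (den′ u) (κ′ v)))

den*κ≤den : ∀ u v → den u ℕ.* κ v ℕ.≤ den (u ++ v)
den*κ≤den u v = subst (den u ℕ.* κ v ℕ.≤_) (sym (den-++ u v)) (ℕ.m≤m+n _ _)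

den-mono : ∀ u v → den u ℕ.≤ den (u ++ v)
den-mono u v = ℕ.≤-trans (ℕ.m≤m*n (den u) (κ v) {{ℕ.>-nonZero (κ≥1 v)}}) (den*κ≤den u v)

den*κ′≤den : ∀ u v → den u ℕ.* κ′ v ℕ.≤ den (u ++ v)
den*κ′≤den u v = ℕ.≤-trans (ℕ.*-monoʳ-≤ (den u) (κ′≤κ v)) (den*κ≤den u v)

convergent-error : ∀ u v →
  den u ℕ.* ℤ.∣ + den u ℤ.* + num (u ++ v) ℤ.- + num u ℤ.* + den (u ++ v) ∣ ℕ.≤ den (u ++ v)
convergent-error u v = subst (λ z → den u ℕ.* z ℕ.≤ den (u ++ v))
  (sym (∣den*num-num*den∣ u v)) (den*κ′≤den u v)

-- Convergents of bounded type are badly approximable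

∣i∣≤∣i+j∣+∣j∣ : ∀ i j → ℤ.∣ i ∣ ℕ.≤ ℤ.∣ i ℤ.+ j ∣ ℕ.+ ℤ.∣ j ∣
∣i∣≤∣i+j∣+∣j∣ i j = subst (λ k → ℤ.∣ k ∣ ℕ.≤ ℤ.∣ i ℤ.+ j ∣ ℕ.+ ℤ.∣ j ∣) (lemma i j)
  (ℤ.∣i-j∣≤∣i∣+∣j∣ (i ℤ.+ j) j)
  where
  lemma : ∀ i j → i ℤ.+ j ℤ.- j ≡ i
  lemma = solve-∀

module _ (u : List ℕ) (q : ℕ) (p : ℤ) (q≥1 : 1 ℕ.≤ q) (2q≤S : 2 ℕ.* q ℕ.≤ den u) where

  private
    S : ℕ
    S = den u

    A : ℤ
    A = + q ℤ.* + num u ℤ.- p ℤ.* + S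

  -- A fraction equal to num u / den u has denominator at least den u, as det = ±1.
  fraction≢convergent : 1 ℕ.≤ ℤ.∣ A ∣
  fraction≢convergent with ℤ.∣ A ∣ in eq
  ... | suc _ = s≤s z≤n
  ... | zero  = contra
    where
    d B : ℤ
    d = det (act u (0 , 1)) (act u (1 , 0))
    B = p ℤ.* + den′ u ℤ.- + q ℤ.* + num′ u
    lemma : ∀ q p x x′ s s′ →
      q ℤ.* (x ℤ.* s′ ℤ.- x′ ℤ.* s) ≡ (q ℤ.* x ℤ.- p ℤ.* s) ℤ.* s′ ℤ.+ s ℤ.* (p ℤ.* s′ ℤ.- q ℤ.* x′)
    lemma = solve-∀
    q≡S*B : q ≡ S ℕ.* ℤ.∣ B ∣
    q≡S*B = trans (sym (ℕ.*-identityʳ q))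
      (trans (cong (q ℕ.*_) (sym (∣det∣≡1 u)))
      (trans (sym (ℤ.abs-* (+ q) d))
      (trans (cong ℤ.∣_∣ (lemma (+ q) p (+ num u) (+ num′ u) (+ S) (+ den′ u)))
      (trans (cong (λ z → ℤ.∣ z ℤ.* + den′ u ℤ.+ + S ℤ.* B ∣) (ℤ.∣i∣≡0⇒i≡0 {A} eq))
      (trans (cong ℤ.∣_∣ (ℤ.+-identityˡ (+ S ℤ.* B))) (ℤ.abs-* (+ S) B))))))
    contra : 1 ℕ.≤ 0
    contra with ℤ.∣ B ∣ | q≡S*B
    ... | zero  | e = subst (1 ℕ.≤_) (trans e (ℕ.*-zeroʳ S)) q≥1
    ... | suc b | e = ℕ.+-cancelˡ-≤ q 1 0 (begin
      q ℕ.+ 1           ≤⟨ ℕ.+-monoʳ-≤ q q≥1 ⟩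
      q ℕ.+ q           ≡⟨ cong (q ℕ.+_) (ℕ.+-identityʳ q) ⟨
      2 ℕ.* q           ≤⟨ 2q≤S ⟩
      S                 ≤⟨ ℕ.m≤m*n S (suc b) ⟩
      S ℕ.* suc b       ≡⟨ e ⟨
      q                 ≡⟨ ℕ.+-identityʳ q ⟨
      q ℕ.+ 0           ∎)
      where open ℕ.≤-Reasoning

  -- The fraction `p / q` differs from the convergent of `u`, so `∣ A ∣` is at least 1. Passing from
  -- that convergent to the longer word destroys at most half of this, because
  -- `2q · κ′ v ≤ S · κ′ v ≤ D`.
  convergent-lower-bound : ∀ v →
    den (u ++ v) ℕ.≤ 2 ℕ.* S ℕ.* ℤ.∣ + q ℤ.* + num (u ++ v) ℤ.- p ℤ.* + den (u ++ v) ∣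
  convergent-lower-bound v = ℕ.+-cancelʳ-≤ D D _ (begin
    D ℕ.+ D
      ≡⟨ cong (D ℕ.+_) (ℕ.+-identityʳ D) ⟨
    2 ℕ.* D
      ≡⟨ cong (2 ℕ.*_) (ℕ.*-identityʳ D) ⟨
    2 ℕ.* (D ℕ.* 1)
      ≤⟨ ℕ.*-monoʳ-≤ 2 (ℕ.*-monoʳ-≤ D fraction≢convergent) ⟩
    2 ℕ.* (D ℕ.* ℤ.∣ A ∣)
      ≡⟨ cong (2 ℕ.*_) (ℤ.abs-* (+ D) A) ⟨
    2 ℕ.* ℤ.∣ + D ℤ.* A ∣
      ≤⟨ ℕ.*-monoʳ-≤ 2 (∣i∣≤∣i+j∣+∣j∣ (+ D ℤ.* A) (+ q ℤ.* C)) ⟩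
    2 ℕ.* (ℤ.∣ + D ℤ.* A ℤ.+ + q ℤ.* C ∣ ℕ.+ ℤ.∣ + q ℤ.* C ∣)
      ≡⟨ cong (λ z → 2 ℕ.* (ℤ.∣ z ∣ ℕ.+ ℤ.∣ + q ℤ.* C ∣)) (lemma (+ q) p (+ num u) (+ S) (+ num (u ++ v)) (+ D)) ⟩
    2 ℕ.* (ℤ.∣ + S ℤ.* E ∣ ℕ.+ ℤ.∣ + q ℤ.* C ∣)
      ≡⟨ cong (2 ℕ.*_) (cong₂ ℕ._+_ (ℤ.abs-* (+ S) E) (trans (ℤ.abs-* (+ q) C) (cong (q ℕ.*_) (∣den*num-num*den∣ u v)))) ⟩
    2 ℕ.* (S ℕ.* ℤ.∣ E ∣ ℕ.+ q ℕ.* κ′ v)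
      ≡⟨ distr S ℤ.∣ E ∣ q (κ′ v) ⟩
    2 ℕ.* S ℕ.* ℤ.∣ E ∣ ℕ.+ 2 ℕ.* q ℕ.* κ′ v
      ≤⟨ ℕ.+-monoʳ-≤ (2 ℕ.* S ℕ.* ℤ.∣ E ∣) (ℕ.≤-trans (ℕ.*-monoˡ-≤ (κ′ v) 2q≤S) (den*κ′≤den u v)) ⟩
    2 ℕ.* S ℕ.* ℤ.∣ E ∣ ℕ.+ D ∎)
    where
    open ℕ.≤-Reasoning
    D : ℕ
    D = den (u ++ v)
    C E : ℤ
    C = + S ℤ.* + num (u ++ v) ℤ.- + num u ℤ.* + D
    E = + q ℤ.* + num (u ++ v) ℤ.- p ℤ.* + D
    lemma : ∀ q p x s y d → d ℤ.* (q ℤ.* x ℤ.- p ℤ.* s) ℤ.+ q ℤ.* (s ℤ.* y ℤ.- x ℤ.* d) ≡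
                            s ℤ.* (q ℤ.* y ℤ.- p ℤ.* d)
    lemma = solve-∀
    distr : ∀ s e q r → 2 ℕ.* (s ℕ.* e ℕ.+ q ℕ.* r) ≡ 2 ℕ.* s ℕ.* e ℕ.+ 2 ℕ.* q ℕ.* r
    distr = ℕSolver.solve-∀

-- The second component never exceeds the first, so a letter below `K` multiplies the first by at
-- most `suc K`. The first value to reach `M` therefore overshoots by at most this factor.
first-crossing : ∀ {K} M w z → proj₂ z ℕ.≤ proj₁ z → proj₁ z ℕ.≤ suc K ℕ.* M →
  All (ℕ._< K) w → M ℕ.≤ proj₁ (act w z) →
  ∃₂ λ u v → u ++ v ≡ w × M ℕ.≤ proj₁ (act u z) × proj₁ (act u z) ℕ.≤ suc K ℕ.* M
first-crossing M []      z z≤ zM _ le = [] , [] , refl , le , zM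
first-crossing {K} M (a ∷ w) z@(x , y) y≤x zM (a<K ∷ ds) le with M ℕ.≤? x
... | yes M≤x = [] , a ∷ w , refl , M≤x , zM
... | no  M≰x =
  let u , v , eq , lo , hi = first-crossing M w (step a z) (step-ordered a z) bound ds le
  in a ∷ u , v , cong (a ∷_) eq , lo , hi
  where
  bound : suc a ℕ.* x ℕ.+ y ℕ.≤ suc K ℕ.* M
  bound = begin
    suc a ℕ.* x ℕ.+ y ≤⟨ ℕ.+-mono-≤ (ℕ.*-monoˡ-≤ x a<K) y≤x ⟩
    K ℕ.* x ℕ.+ x     ≡⟨ ℕ.+-comm (K ℕ.* x) x ⟩
    suc K ℕ.* x       ≤⟨ ℕ.*-monoʳ-≤ (suc K) (ℕ.<⇒≤ (ℕ.≰⇒> M≰x)) ⟩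
    suc K ℕ.* M       ∎
    where open ℕ.≤-Reasoning

-- Some prefix `u` has a denominator between `2q` and `2q · suc K`. Inserting it into the bound
-- `2 · den u · e` of `convergent-lower-bound` yields the constant `4 · suc K`.
bounded-digits⇒bad : ∀ {K} w → All (ℕ._< K) w → ∀ q p → 1 ℕ.≤ q → 2 ℕ.* q ℕ.≤ den w → ∀ v →
  den (w ++ v) ℕ.≤
    4 ℕ.* suc K ℕ.* (q ℕ.* ℤ.∣ + q ℤ.* + num (w ++ v) ℤ.- p ℤ.* + den (w ++ v) ∣)
bounded-digits⇒bad {K} w ds q p q≥1 2q≤ v
  with first-crossing {K} (2 ℕ.* q) w (1 , 0) z≤n 1≤ ds 2q≤
  where
  1≤ : 1 ℕ.≤ suc K ℕ.* (2 ℕ.* q)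
  1≤ = ℕ.*-mono-≤ {1} {suc K} (s≤s z≤n) (ℕ.≤-trans q≥1 (ℕ.m≤m+n q (q ℕ.+ 0)))
... | u , v′ , refl , lo , hi = subst
  (λ l → den l ℕ.≤ 4 ℕ.* suc K ℕ.* (q ℕ.* ℤ.∣ + q ℤ.* + num l ℤ.- p ℤ.* + den l ∣))
  (sym (++-assoc u v′ v)) (begin
    den l                                    ≤⟨ convergent-lower-bound u q p q≥1 lo (v′ ++ v) ⟩
    2 ℕ.* den u ℕ.* e                        ≤⟨ ℕ.*-monoˡ-≤ e (ℕ.*-monoʳ-≤ 2 hi) ⟩
    2 ℕ.* (suc K ℕ.* (2 ℕ.* q)) ℕ.* e        ≡⟨ lemma (suc K) q e ⟩
    4 ℕ.* suc K ℕ.* (q ℕ.* e)                ∎)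
  where
  open ℕ.≤-Reasoning
  l : List ℕ
  l = u ++ v′ ++ v
  e : ℕ
  e = ℤ.∣ + q ℤ.* + num l ℤ.- p ℤ.* + den l ∣
  lemma : ∀ k q e → 2 ℕ.* (k ℕ.* (2 ℕ.* q)) ℕ.* e ≡ 4 ℕ.* k ℕ.* (q ℕ.* e)
  lemma = ℕSolver.solve-∀

-- Euclid's algorithm for X / D prepends each quotient, so its word is the reversed
-- expansion; the badness hypothesis bounds the quotients.
module Euclid (X : ℤ) (D K Q : ℕ) (D≥1 : 1 ℕ.≤ D) (Q≥1 : 1 ℕ.≤ Q)
  (bad : ∀ q p → 1 ℕ.≤ q → q ℕ.≤ suc K ℕ.* Q → D ℕ.≤ K ℕ.* (q ℕ.* ℤ.∣ + q ℤ.* X ℤ.- p ℤ.* + D ∣))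
  where

  -- Here `e` and `e′` are the errors of two consecutive convergents of `X / D`, scaled by `D`, and
  -- `σ` carries their alternating sign. The field `conserved` is the determinant identity in the
  -- form that bounds `e′` by `D / κ w`.
  record Remainders (w : List ℕ) (e e′ : ℕ) : Set where
    field
      p p′ σ   : ℤ
      ∣σ∣≡1    : ℤ.∣ σ ∣ ≡ 1
      remainder  : + κ w ℤ.* X ℤ.- p ℤ.* + D ≡ σ ℤ.* + e
      remainder′ : + κ′ w ℤ.* X ℤ.- p′ ℤ.* + D ≡ ℤ.- σ ℤ.* + e′
      conserved  : κ w ℕ.* e′ ℕ.+ κ′ w ℕ.* e ≡ D
      e<e′       : e ℕ.< e′

  Approximates : List ℕ → Set
  Approximates w =
    (∃ λ p → κ w ℕ.* ℤ.∣ + κ w ℤ.* X ℤ.- p ℤ.* + D ∣ ℕ.≤ D) ×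
    (∃ λ p → κ w ℕ.* ℤ.∣ + κ′ w ℤ.* X ℤ.- p ℤ.* + D ∣ ℕ.≤ D)

  remainder-size : ∀ {w e e′} (R : Remainders w e e′) →
    let open Remainders R in
    ℤ.∣ + κ w ℤ.* X ℤ.- p ℤ.* + D ∣ ≡ e × ℤ.∣ + κ′ w ℤ.* X ℤ.- p′ ℤ.* + D ∣ ≡ e′
  remainder-size {w} {e} {e′} R =
    trans (cong ℤ.∣_∣ remainder) (trans (ℤ.abs-* σ (+ e)) (unit ∣σ∣≡1 e)) ,
    trans (cong ℤ.∣_∣ remainder′) (trans (ℤ.abs-* (ℤ.- σ) (+ e′))
      (unit (trans (ℤ.∣-i∣≡∣i∣ σ) ∣σ∣≡1) e′))
    where
    open Remainders R
    unit : ∀ {s} → s ≡ 1 → ∀ e → s ℕ.* e ≡ e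
    unit refl e = ℕ.*-identityˡ e

  approximates : ∀ {w e e′} → Remainders w e e′ → Approximates w
  approximates {w} {e} {e′} R =
    (p , subst (λ z → κ w ℕ.* z ℕ.≤ D) (sym (proj₁ (remainder-size R)))
      (ℕ.≤-trans (ℕ.*-monoʳ-≤ (κ w) (ℕ.<⇒≤ e<e′)) qe′≤D)) ,
    (p′ , subst (λ z → κ w ℕ.* z ℕ.≤ D) (sym (proj₂ (remainder-size R))) qe′≤D)
    where
    open Remainders R
    qe′≤D : κ w ℕ.* e′ ℕ.≤ D
    qe′≤D = subst (κ w ℕ.* e′ ℕ.≤_) conserved (ℕ.m≤m+n _ _)

  Next : List ℕ → Set
  Next w = ∃ λ a → a ℕ.< K × ∃₂ λ e e′ → Remainders (a ∷ w) e e′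

  next : ∀ {w e e′} → Remainders w e e′ → κ w ℕ.≤ suc K ℕ.* Q → Next w
  -- A vanishing remainder would turn badness into `D ≤ 0`, so the expansion cannot end while `κ w`
  -- is in the range of the hypothesis.
  next {w} {zero} R q≤ with subst (λ z → D ℕ.≤ K ℕ.* (κ w ℕ.* z)) (proj₁ (remainder-size R))
                               (bad (κ w) (Remainders.p R) (κ≥1 w) q≤)
  ... | D≤ with ℕ.≤-trans D≥1 (subst (D ℕ.≤_) (trans (cong (K ℕ.*_) (ℕ.*-zeroʳ (κ w))) (ℕ.*-zeroʳ K)) D≤)
  ...   | ()
  next {w} {e@(suc _)} {e′} R q≤ with e′ ℕ./ e in a≡
  ... | zero with subst (0 ℕ.<_) a≡ (ℕ.m≥n⇒m/n>0 (ℕ.<⇒≤ (Remainders.e<e′ R)))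
  ...   | ()
  next {w} {e@(suc _)} {e′} R q≤ | suc a = a , a<K , e′ ℕ.% e , e , record
    { p = + suc a ℤ.* p ℤ.+ p′
    ; p′ = p
    ; σ = ℤ.- σ
    ; ∣σ∣≡1 = trans (ℤ.∣-i∣≡∣i∣ σ) ∣σ∣≡1
    ; remainder = remainder-step
    ; remainder′ = trans remainder (cong (ℤ._* + e) (sym (ℤ.neg-involutive σ)))
    ; conserved = trans (lemma₃ (suc a) (κ w) (κ′ w) e r)
        (trans (cong (λ z → κ w ℕ.* z ℕ.+ κ′ w ℕ.* e) (sym e′≡)) conserved)
    ; e<e′ = ℕ.m%n<n e′ e
    }
    where
    open Remainders R
    r : ℕ
    r = e′ ℕ.% e
    e′≡ : e′ ≡ r ℕ.+ suc a ℕ.* e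
    e′≡ = trans (ℕ.m≡m%n+[m/n]*n e′ e) (cong (λ z → r ℕ.+ z ℕ.* e) a≡)
    +e′ : + e′ ≡ + r ℤ.+ + suc a ℤ.* + e
    +e′ = trans (cong +_ e′≡) (cong (λ z → + r ℤ.+ z) (ℤ.pos-* (suc a) e))
    lemma₁ : ∀ a q r x p p′ d → (a ℤ.* q ℤ.+ r) ℤ.* x ℤ.- (a ℤ.* p ℤ.+ p′) ℤ.* d ≡
                                a ℤ.* (q ℤ.* x ℤ.- p ℤ.* d) ℤ.+ (r ℤ.* x ℤ.- p′ ℤ.* d)
    lemma₁ = solve-∀
    lemma₂ : ∀ a s e r → a ℤ.* (s ℤ.* e) ℤ.+ ℤ.- s ℤ.* (r ℤ.+ a ℤ.* e) ≡ ℤ.- s ℤ.* r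
    lemma₂ = solve-∀
    lemma₃ : ∀ a q s e r → (a ℕ.* q ℕ.+ s) ℕ.* e ℕ.+ q ℕ.* r ≡ q ℕ.* (r ℕ.+ a ℕ.* e) ℕ.+ s ℕ.* e
    lemma₃ = ℕSolver.solve-∀
    remainder-step : + (suc a ℕ.* κ w ℕ.+ κ′ w) ℤ.* X ℤ.- (+ suc a ℤ.* p ℤ.+ p′) ℤ.* + D ≡ ℤ.- σ ℤ.* + r
    remainder-step = begin
      + (suc a ℕ.* κ w ℕ.+ κ′ w) ℤ.* X ℤ.- (+ suc a ℤ.* p ℤ.+ p′) ℤ.* + D
        ≡⟨ cong (λ z → (z ℤ.+ + κ′ w) ℤ.* X ℤ.- (+ suc a ℤ.* p ℤ.+ p′) ℤ.* + D)
             (ℤ.pos-* (suc a) (κ w)) ⟩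
      (+ suc a ℤ.* + κ w ℤ.+ + κ′ w) ℤ.* X ℤ.- (+ suc a ℤ.* p ℤ.+ p′) ℤ.* + D
        ≡⟨ lemma₁ (+ suc a) (+ κ w) (+ κ′ w) X p p′ (+ D) ⟩
      + suc a ℤ.* (+ κ w ℤ.* X ℤ.- p ℤ.* + D) ℤ.+ (+ κ′ w ℤ.* X ℤ.- p′ ℤ.* + D)
        ≡⟨ cong₂ (λ y z → + suc a ℤ.* y ℤ.+ z) remainder remainder′ ⟩
      + suc a ℤ.* (σ ℤ.* + e) ℤ.+ ℤ.- σ ℤ.* + e′
        ≡⟨ cong (λ z → + suc a ℤ.* (σ ℤ.* + e) ℤ.+ ℤ.- σ ℤ.* z) +e′ ⟩
      + suc a ℤ.* (σ ℤ.* + e) ℤ.+ ℤ.- σ ℤ.* (+ r ℤ.+ + suc a ℤ.* + e)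
        ≡⟨ lemma₂ (+ suc a) σ (+ e) (+ r) ⟩
      ℤ.- σ ℤ.* + r ∎
      where open ≡.≡-Reasoning
    -- By `conserved`, `e′` is at most `D / κ w`; by badness, `e` is at least `D / (K · κ w)`. The
    -- quotient of `e′` by `e` is thus at most `K`.
    a<K : a ℕ.< K
    a<K = ℕ.*-cancelʳ-≤ (suc a) K (κ w ℕ.* e)
      {{ℕ.>-nonZero (ℕ.*-mono-≤ {1} {κ w} {1} {e} (κ≥1 w) (s≤s z≤n))}} le
      where
      open ℕ.≤-Reasoning
      comm : ∀ a q e → a ℕ.* (q ℕ.* e) ≡ q ℕ.* (a ℕ.* e)
      comm = ℕSolver.solve-∀
      le : suc a ℕ.* (κ w ℕ.* e) ℕ.≤ K ℕ.* (κ w ℕ.* e)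
      le = begin
        suc a ℕ.* (κ w ℕ.* e)        ≡⟨ comm (suc a) (κ w) e ⟩
        κ w ℕ.* (suc a ℕ.* e)        ≤⟨ ℕ.*-monoʳ-≤ (κ w) (ℕ.m≤n+m _ r) ⟩
        κ w ℕ.* (r ℕ.+ suc a ℕ.* e)  ≡⟨ cong (κ w ℕ.*_) e′≡ ⟨
        κ w ℕ.* e′                   ≤⟨ ℕ.m≤m+n _ _ ⟩
        κ w ℕ.* e′ ℕ.+ κ′ w ℕ.* e    ≡⟨ conserved ⟩
        D                             ≤⟨ bad (κ w) p (κ≥1 w) q≤ ⟩
        K ℕ.* (κ w ℕ.* ℤ.∣ + κ w ℤ.* X ℤ.- p ℤ.* + D ∣)
          ≡⟨ cong (λ z → K ℕ.* (κ w ℕ.* z)) (proj₁ (remainder-size R)) ⟩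
        K ℕ.* (κ w ℕ.* e)            ∎

  private instance
    D≢0 : NonZero D
    D≢0 = ℕ.>-nonZero D≥1

  start : Remainders [] (X ℤ.%ℕ D) D

  start = record
    { p = X ℤ./ℕ D ; p′ = + 1 ; σ = + 1
    ; ∣σ∣≡1 = refl
    ; remainder = trans (cong (λ z → + 1 ℤ.* z ℤ.- X ℤ./ℕ D ℤ.* + D) (ℤ.a≡a%ℕn+[a/ℕn]*n X D))
        (lemma₁ (+ (X ℤ.%ℕ D)) (X ℤ./ℕ D ℤ.* + D))
    ; remainder′ = lemma₂ X (+ D)
    ; conserved = lemma₃ D (X ℤ.%ℕ D)
    ; e<e′ = ℤ.n%ℕd<d X D
    }
    where
    lemma₁ : ∀ r m → + 1 ℤ.* (r ℤ.+ m) ℤ.- m ≡ + 1 ℤ.* r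
    lemma₁ = solve-∀
    lemma₂ : ∀ x d → + 0 ℤ.* x ℤ.- + 1 ℤ.* d ≡ ℤ.- (+ 1) ℤ.* d
    lemma₂ = solve-∀
    lemma₃ : ∀ d e → 1 ℕ.* d ℕ.+ 0 ℕ.* e ≡ d
    lemma₃ = ℕSolver.solve-∀

  Result : Set
  Result = ∃ λ w → All (ℕ._< K) w × Q ℕ.≤ κ w × κ w ℕ.≤ suc K ℕ.* Q × Approximates w

  -- The sum `κ w + κ′ w` grows with every letter, and `κ′ w ≤ κ w`, so when the fuel is spent
  -- `2Q ≤ 2 · κ w`. The bound on the letters limits the overshoot of the last step.
  run : ∀ fuel w {e e′} → Remainders w e e′ → All (ℕ._< K) w → κ w ℕ.≤ suc K ℕ.* Q →
        2 ℕ.* Q ℕ.≤ fuel ℕ.+ (κ w ℕ.+ κ′ w) → Result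
  run fuel w R ds q≤ le with Q ℕ.≤? κ w
  ... | yes Q≤q = w , ds , Q≤q , q≤ , approximates R
  run zero w R ds q≤ le | no Q≰q = w , ds , Q≤q , q≤ , approximates R
    where
    Q≤q : Q ℕ.≤ κ w
    Q≤q = ℕ.*-cancelˡ-≤ 2 (ℕ.≤-trans le
      (ℕ.+-monoʳ-≤ (κ w) (ℕ.≤-trans (κ′≤κ w) (ℕ.≤-reflexive (sym (ℕ.+-identityʳ (κ w)))))))
  run (suc fuel) w R ds q≤ le | no Q≰q =
    let a , a<K , _ , _ , R′ = next R q≤
    in run fuel (a ∷ w) R′ (a<K ∷ ds) (bound a a<K) (progress a)
    where
    open ℕ.≤-Reasoning
    bound : ∀ a → a ℕ.< K → suc a ℕ.* κ w ℕ.+ κ′ w ℕ.≤ suc K ℕ.* Q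
    bound a a<K = begin
      suc a ℕ.* κ w ℕ.+ κ′ w ≤⟨ ℕ.+-mono-≤ (ℕ.*-monoˡ-≤ (κ w) a<K) (κ′≤κ w) ⟩
      K ℕ.* κ w ℕ.+ κ w     ≡⟨ ℕ.+-comm (K ℕ.* κ w) (κ w) ⟩
      suc K ℕ.* κ w          ≤⟨ ℕ.*-monoʳ-≤ (suc K) (ℕ.<⇒≤ (ℕ.≰⇒> Q≰q)) ⟩
      suc K ℕ.* Q             ∎
    progress : ∀ a → 2 ℕ.* Q ℕ.≤ fuel ℕ.+ (suc a ℕ.* κ w ℕ.+ κ′ w ℕ.+ κ w)
    progress a = begin
      2 ℕ.* Q                           ≤⟨ le ⟩
      suc (fuel ℕ.+ (κ w ℕ.+ κ′ w))    ≡⟨ ℕ.+-suc fuel _ ⟨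
      fuel ℕ.+ (1 ℕ.+ (κ w ℕ.+ κ′ w))  ≤⟨ ℕ.+-monoʳ-≤ fuel (ℕ.+-mono-≤ (κ≥1 w)
                                             (ℕ.+-monoˡ-≤ (κ′ w) (ℕ.m≤m+n (κ w) (a ℕ.* κ w)))) ⟩
      fuel ℕ.+ (κ w ℕ.+ (suc a ℕ.* κ w ℕ.+ κ′ w))
        ≡⟨ cong (fuel ℕ.+_) (ℕ.+-comm (κ w) _) ⟩
      fuel ℕ.+ (suc a ℕ.* κ w ℕ.+ κ′ w ℕ.+ κ w) ∎

  result : Result
  result = run (2 ℕ.* Q) [] start [] (ℕ.*-mono-≤ {1} {suc K} (s≤s z≤n) Q≥1) (ℕ.m≤m+n _ _)

-- From integers to rationals

ι : ℕ → ℚ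
ι n = fromℤ (+ n)

fromℤ-* : ∀ i j → fromℤ (i ℤ.* j) ≡ fromℤ i ℚ.* fromℤ j
fromℤ-* i j = sym (cong₂ ℚ._*_ (fromℤ≡toℚ i) (fromℤ≡toℚ j))

fromℤ-+ : ∀ i j → fromℤ (i ℤ.+ j) ≡ fromℤ i ℚ.+ fromℤ j
fromℤ-+ i j = sym (trans (cong₂ ℚ._+_ (fromℤ≡toℚ i) (fromℤ≡toℚ j))
  (cong fromℤ (cong₂ ℤ._+_ (ℤ.*-identityʳ i) (ℤ.*-identityʳ j))))

fromℤ-- : ∀ i j → fromℤ (i ℤ.- j) ≡ fromℤ i ℚ.- fromℤ j
fromℤ-- i j = trans (fromℤ-+ i (ℤ.- j)) (cong (fromℤ i ℚ.+_) (fromℤ-neg j))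

∣fromℤ∣ : ∀ i → ℚ.∣ fromℤ i ∣ ≡ ι ℤ.∣ i ∣
∣fromℤ∣ i = trans (cong ℚ.∣_∣ (fromℤ≡toℚ i)) (trans (lemma i) (sym (fromℤ≡toℚ (+ ℤ.∣ i ∣))))
  where
  lemma : ∀ i → ℚ.∣ toℚ i ∣ ≡ toℚ (+ ℤ.∣ i ∣)
  lemma (+ _)    = refl
  lemma -[1+ _ ] = refl

ι-* : ∀ m n → ι (m ℕ.* n) ≡ ι m ℚ.* ι n
ι-* m n = trans (cong fromℤ (ℤ.pos-* m n)) (fromℤ-* (+ m) (+ n))

ι-+ : ∀ m n → ι (m ℕ.+ n) ≡ ι m ℚ.+ ι n
ι-+ m n = fromℤ-+ (+ m) (+ n)

ι-mono-≤ : ∀ {m n} → m ℕ.≤ n → ι m ℚ.≤ ι n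
ι-mono-≤ m≤n = fromℤ-mono-≤ (ℤ.+≤+ m≤n)

ι-cancel-≤ : ∀ {m n} → ι m ℚ.≤ ι n → m ℕ.≤ n
ι-cancel-≤ {m} {n} le with ≡.subst₂ ℚ._≤_ (fromℤ≡toℚ (+ m)) (fromℤ≡toℚ (+ n)) le
... | ℚ.*≤* le′ = ℤ.drop‿+≤+
  (≡.subst₂ ℤ._≤_ (ℤ.*-identityʳ (+ m)) (ℤ.*-identityʳ (+ n)) le′)

ι≥0 : ∀ n → 0ℚ ℚ.≤ ι n
ι≥0 n = ι-mono-≤ {0} {n} z≤n

1≤ι : ∀ {n} → 1 ℕ.≤ n → 1ℚ ℚ.≤ ι n
1≤ι = ι-mono-≤

ι>0 : ∀ {n} → 1 ℕ.≤ n → 0ℚ ℚ.< ι n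
ι>0 n≥1 = ℚ.<-≤-trans (ℚ.positive⁻¹ 1ℚ) (1≤ι n≥1)

*-monoʳ-ℚ : ∀ {r p q} → 0ℚ ℚ.≤ r → p ℚ.≤ q → r ℚ.* p ℚ.≤ r ℚ.* q
*-monoʳ-ℚ {r} r≥0 = ℚ.*-monoˡ-≤-nonNeg r {{ℚ.nonNegative r≥0}}

*-monoˡ-ℚ : ∀ {r p q} → 0ℚ ℚ.≤ r → p ℚ.≤ q → p ℚ.* r ℚ.≤ q ℚ.* r
*-monoˡ-ℚ {r} r≥0 = ℚ.*-monoʳ-≤-nonNeg r {{ℚ.nonNegative r≥0}}

*-cancelʳ-ℚ : ∀ {r p q} → 0ℚ ℚ.< r → p ℚ.* r ℚ.≤ q ℚ.* r → p ℚ.≤ q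
*-cancelʳ-ℚ {r} r>0 = ℚ.*-cancelʳ-≤-pos r {{ℚ.positive r>0}}

*-nonNeg-ℚ : ∀ {p q} → 0ℚ ℚ.≤ p → 0ℚ ℚ.≤ q → 0ℚ ℚ.≤ p ℚ.* q
*-nonNeg-ℚ {p} {q} p≥0 q≥0 = subst (ℚ._≤ p ℚ.* q) (ℚ.*-zeroˡ q) (*-monoˡ-ℚ q≥0 p≥0)

∣k*p∣≡k*∣p∣ : ∀ {k} → 0ℚ ℚ.≤ k → ∀ p → ℚ.∣ k ℚ.* p ∣ ≡ k ℚ.* ℚ.∣ p ∣
∣k*p∣≡k*∣p∣ {k} k≥0 p = trans (ℚ.∣p*q∣≡∣p∣*∣q∣ k p) (cong (ℚ._* ℚ.∣ p ∣) (ℚ.0≤p⇒∣p∣≡p k≥0))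

numerator : ∀ x → x ℚ.* ι (ℚ.↧ₙ x) ≡ fromℤ (ℚ.↥ x)
numerator x@(mkℚ n d-1 _) = trans (cong (x ℚ.*_) (fromℤ≡toℚ (+ suc d-1)))
  (ℚ.fromℚᵘ-cong {ℚᵘ.mkℚᵘ (n ℤ.* + suc d-1) (d-1 ℕ.* 1)} {ℚᵘ.mkℚᵘ n 0} (ℚᵘ.*≡* (trans (ℤ.*-identityʳ (n ℤ.* + suc d-1))
    (cong (λ m → n ℤ.* + suc m) (sym (ℕ.*-identityʳ d-1))))))

-- The denominator of `ε` is the witness: its product with `ε` is the numerator, a positive integer.
archimedean : ∀ {ε} → 0ℚ ℚ.< ε → ∃ λ n → 1 ℕ.≤ n × 1ℚ ℚ.≤ ι n ℚ.* ε
archimedean {mkℚ -[1+ _ ] _ _} (ℚ.*<* ())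
archimedean {mkℚ (+ 0) _ _} (ℚ.*<* (ℤ.+<+ ()))
archimedean {ε@(mkℚ (+ suc n) d-1 _)} _ = suc d-1 , s≤s z≤n ,
  subst (1ℚ ℚ.≤_) (trans (sym (numerator ε)) (ℚ.*-comm ε (ι (suc d-1)))) (1≤ι {suc n} (s≤s z≤n))

-- A fraction x = X / D is handled through the equation x D = X.
module Fraction {x X D} (D≥1 : 1 ℕ.≤ D) (x*D≡X : x ℚ.* ι D ≡ fromℤ X) where

  clear-denominator : ∀ q p →
    ℚ.∣ ι q ℚ.* x ℚ.- fromℤ p ∣ ℚ.* ι D ≡ ι ℤ.∣ + q ℤ.* X ℤ.- p ℤ.* + D ∣
  clear-denominator q p = begin
    ℚ.∣ y ∣ ℚ.* ι D                                ≡⟨ ℚ.*-comm ℚ.∣ y ∣ (ι D) ⟩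
    ι D ℚ.* ℚ.∣ y ∣                                ≡⟨ ∣k*p∣≡k*∣p∣ (ι≥0 D) y ⟨
    ℚ.∣ ι D ℚ.* y ∣                                ≡⟨ cong ℚ.∣_∣ (lemma (ι D) (ι q) x (fromℤ p)) ⟩
    ℚ.∣ ι q ℚ.* (x ℚ.* ι D) ℚ.- fromℤ p ℚ.* ι D ∣  ≡⟨ cong (λ z → ℚ.∣ ι q ℚ.* z ℚ.- fromℤ p ℚ.* ι D ∣) x*D≡X ⟩
    ℚ.∣ ι q ℚ.* fromℤ X ℚ.- fromℤ p ℚ.* ι D ∣
      ≡⟨ cong₂ (λ a b → ℚ.∣ a ℚ.- b ∣) (fromℤ-* (+ q) X) (fromℤ-* p (+ D)) ⟨
    ℚ.∣ fromℤ (+ q ℤ.* X) ℚ.- fromℤ (p ℤ.* + D) ∣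
      ≡⟨ cong ℚ.∣_∣ (fromℤ-- (+ q ℤ.* X) (p ℤ.* + D)) ⟨
    ℚ.∣ fromℤ (+ q ℤ.* X ℤ.- p ℤ.* + D) ∣          ≡⟨ ∣fromℤ∣ (+ q ℤ.* X ℤ.- p ℤ.* + D) ⟩
    ι ℤ.∣ + q ℤ.* X ℤ.- p ℤ.* + D ∣                ∎
    where
    open ≡.≡-Reasoning
    y : ℚ
    y = ι q ℚ.* x ℚ.- fromℤ p
    lemma : ∀ d q x p → d ℚ.* (q ℚ.* x ℚ.- p) ≡ q ℚ.* (x ℚ.* d) ℚ.- p ℚ.* d
    lemma = solve 4 (λ d q x p → d :* (q :* x :- p) := q :* (x :* d) :- p :* d) refl
      where open +-*-Solver

  clear-denominator-* : ∀ k q p →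
    ι k ℚ.* ℚ.∣ ι q ℚ.* x ℚ.- fromℤ p ∣ ℚ.* ι D ≡ ι (k ℕ.* ℤ.∣ + q ℤ.* X ℤ.- p ℤ.* + D ∣)
  clear-denominator-* k q p = trans (ℚ.*-assoc (ι k) _ (ι D))
    (trans (cong (ι k ℚ.*_) (clear-denominator q p)) (sym (ι-* k _)))

  clear-denominator-** : ∀ l k q p →
    ι l ℚ.* (ι k ℚ.* ℚ.∣ ι q ℚ.* x ℚ.- fromℤ p ∣) ℚ.* ι D ≡
    ι (l ℕ.* (k ℕ.* ℤ.∣ + q ℤ.* X ℤ.- p ℤ.* + D ∣))
  clear-denominator-** l k q p = trans (ℚ.*-assoc (ι l) _ (ι D))
    (trans (cong (ι l ℚ.*_) (clear-denominator-* k q p)) (sym (ι-* l _)))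

  upper-bound : ∀ k q p → k ℕ.* ℤ.∣ + q ℤ.* X ℤ.- p ℤ.* + D ∣ ℕ.≤ D →
                ι k ℚ.* ℚ.∣ ι q ℚ.* x ℚ.- fromℤ p ∣ ℚ.≤ 1ℚ
  upper-bound k q p le = *-cancelʳ-ℚ (ι>0 D≥1)
    (≡.subst₂ ℚ._≤_ (sym (clear-denominator-* k q p)) (sym (ℚ.*-identityˡ (ι D))) (ι-mono-≤ le))

  lower-bound : ∀ l k q p → D ℕ.≤ l ℕ.* (k ℕ.* ℤ.∣ + q ℤ.* X ℤ.- p ℤ.* + D ∣) →
                1ℚ ℚ.≤ ι l ℚ.* (ι k ℚ.* ℚ.∣ ι q ℚ.* x ℚ.- fromℤ p ∣)
  lower-bound l k q p le = *-cancelʳ-ℚ (ι>0 D≥1)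
    (≡.subst₂ ℚ._≤_ (sym (ℚ.*-identityˡ (ι D))) (sym (clear-denominator-** l k q p)) (ι-mono-≤ le))

  lower-bound⁻¹ : ∀ l k q p → 1ℚ ℚ.≤ ι l ℚ.* (ι k ℚ.* ℚ.∣ ι q ℚ.* x ℚ.- fromℤ p ∣) →
                  D ℕ.≤ l ℕ.* (k ℕ.* ℤ.∣ + q ℤ.* X ℤ.- p ℤ.* + D ∣)
  lower-bound⁻¹ l k q p le = ι-cancel-≤
    (≡.subst₂ ℚ._≤_ (ℚ.*-identityˡ (ι D)) (clear-denominator-** l k q p)
      (*-monoˡ-ℚ (ι≥0 D) le))

-- Approximating α by reversed expansions

eventually-map : ∀ {P Q : Pred ℕ 0ℓ} → (∀ n → P n → Q n) → Eventually P → Eventually Q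
eventually-map f (N , p) = N , λ n le → f n (p n le)

-- The index from which the badness inequality holds depends on `q`; over a finite range of `q` a
-- maximum of indices serves for all.
eventually-∀≤ : ∀ {P : ℕ → Pred ℕ 0ℓ} → (∀ q → Eventually (P q)) →
                ∀ Q → Eventually (λ n → ∀ q → q ℕ.≤ Q → P q n)
eventually-∀≤ {P} ev zero = eventually-map (λ { n p .0 z≤n → p }) (ev 0)
eventually-∀≤ {P} ev (suc Q) =
  eventually-map f (both (ev (suc Q)) (eventually-∀≤ {P} ev Q))
  where
  f : ∀ n → P (suc Q) n × (∀ q → q ℕ.≤ Q → P q n) → ∀ q → q ℕ.≤ suc Q → P q n
  f n (p , ps) q q≤ with q ℕ.≤? Q
  ... | yes q≤Q = ps q q≤Q
  ... | no  q≰Q = subst (λ q → P q n) (ℕ.≤-antisym (ℕ.≰⇒> q≰Q) q≤) p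

module _ where
  open +-*-Solver

  kx-p≡[ky-p]+k[x-y] : ∀ k x y p → k ℚ.* x ℚ.- p ≡ (k ℚ.* y ℚ.- p) ℚ.+ k ℚ.* (x ℚ.- y)
  kx-p≡[ky-p]+k[x-y] = solve 4 (λ k x y p → k :* x :- p := (k :* y :- p) :+ k :* (x :- y)) refl

∣kx-p∣≤ : ∀ {k} → 0ℚ ℚ.≤ k → ∀ x y p →
  ℚ.∣ k ℚ.* x ℚ.- p ∣ ℚ.≤ ℚ.∣ k ℚ.* y ℚ.- p ∣ ℚ.+ k ℚ.* ℚ.∣ x ℚ.- y ∣
∣kx-p∣≤ {k} k≥0 x y p = begin
  ℚ.∣ k ℚ.* x ℚ.- p ∣                              ≡⟨ cong ℚ.∣_∣ (kx-p≡[ky-p]+k[x-y] k x y p) ⟩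
  ℚ.∣ (k ℚ.* y ℚ.- p) ℚ.+ k ℚ.* (x ℚ.- y) ∣        ≤⟨ ℚ.∣p+q∣≤∣p∣+∣q∣ (k ℚ.* y ℚ.- p) (k ℚ.* (x ℚ.- y)) ⟩
  ℚ.∣ k ℚ.* y ℚ.- p ∣ ℚ.+ ℚ.∣ k ℚ.* (x ℚ.- y) ∣    ≡⟨ cong (ℚ.∣ k ℚ.* y ℚ.- p ∣ ℚ.+_) (∣k*p∣≡k*∣p∣ k≥0 (x ℚ.- y)) ⟩
  ℚ.∣ k ℚ.* y ℚ.- p ∣ ℚ.+ k ℚ.* ℚ.∣ x ℚ.- y ∣      ∎
  where open ℚ.≤-Reasoning

BadWith : ℕ → Pred ℝ 0ℓ
BadWith K α = ∀ q → 1 ℕ.≤ q → Eventually λ n → 1ℚ ℚ.≤ ι K ℚ.* (ι q ℚ.* ‖ ι q ℚ.* seq α n ‖ℚ)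

bad⇒badWith : ∀ {α} → α ∈ Bad → ∃ λ K → BadWith K α
bad⇒badWith {α} (c , (ε , ε>0 , 0+ε≤c) , c≤) =
  -- The order on reals passes to terms only up to an error, and half of `ε` pays for it.
  let K , _ , 1≤Kε = archimedean (ε/2-pos ε>0) in K , λ q q≥1 →
    eventually-map (λ n (ε≤c , c≤f) → ℚ.≤-trans 1≤Kε (*-monoʳ-ℚ (ι≥0 K) (
      ε≤x+ε/2⇒ε/2≤x (ℚ.≤-trans (subst (ℚ._≤ seq c n) (ℚ.+-identityˡ ε) ε≤c) c≤f))))
      (both 0+ε≤c (c≤ q {{ℕ.>-nonZero q≥1}} (ε/2 ε) (ε/2-pos ε>0)))
  where
  ε≤x+ε/2⇒ε/2≤x : ∀ {x} → ε ℚ.≤ x ℚ.+ ε/2 ε → ε/2 ε ℚ.≤ x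
  ε≤x+ε/2⇒ε/2≤x {x} le = ≡.subst₂ ℚ._≤_
    (trans (cong (ℚ._- ε/2 ε) (sym (ε/2+ε/2 ε))) ([q+d]-q≡d (ε/2 ε) (ε/2 ε)))
    (trans (cong (ℚ._- ε/2 ε) (ℚ.+-comm x (ε/2 ε))) ([q+d]-q≡d (ε/2 ε) x))
    (ℚ.+-monoˡ-≤ (ℚ.- ε/2 ε) le)

ι-linear : ∀ S S′ q q′ → ι (S ℕ.* q ℕ.+ S′ ℕ.* q′) ≡ ι S ℚ.* ι q ℚ.+ ι S′ ℚ.* ι q′
ι-linear S S′ q q′ = trans (ι-+ (S ℕ.* q) (S′ ℕ.* q′)) (cong₂ ℚ._+_ (ι-* S q) (ι-* S′ q′))

-- The integer `S p + S′ p′` competes with the nearest one.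
‖lin‖≤ : ∀ S S′ q q′ x p p′ →
  ‖ ι (S ℕ.* q ℕ.+ S′ ℕ.* q′) ℚ.* x ‖ℚ ℚ.≤
  ι S ℚ.* ℚ.∣ ι q ℚ.* x ℚ.- fromℤ p ∣ ℚ.+ ι S′ ℚ.* ℚ.∣ ι q′ ℚ.* x ℚ.- fromℤ p′ ∣
‖lin‖≤ S S′ q q′ x p p′ = begin
  ‖ ι (S ℕ.* q ℕ.+ S′ ℕ.* q′) ℚ.* x ‖ℚ
    ≤⟨ ‖p‖≤∣p-k∣ (ι (S ℕ.* q ℕ.+ S′ ℕ.* q′) ℚ.* x) k ⟩
  ℚ.∣ ι (S ℕ.* q ℕ.+ S′ ℕ.* q′) ℚ.* x ℚ.- fromℤ k ∣
    ≡⟨ cong₂ (λ a b → ℚ.∣ a ℚ.* x ℚ.- b ∣) (ι-linear S S′ q q′)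
         (trans (fromℤ-+ (+ S ℤ.* p) (+ S′ ℤ.* p′)) (cong₂ ℚ._+_ (fromℤ-* (+ S) p) (fromℤ-* (+ S′) p′))) ⟩
  ℚ.∣ (ι S ℚ.* ι q ℚ.+ ι S′ ℚ.* ι q′) ℚ.* x ℚ.- (ι S ℚ.* fromℤ p ℚ.+ ι S′ ℚ.* fromℤ p′) ∣
    ≡⟨ cong ℚ.∣_∣ (lemma (ι S) (ι S′) (ι q) (ι q′) x (fromℤ p) (fromℤ p′)) ⟩
  ℚ.∣ ι S ℚ.* y ℚ.+ ι S′ ℚ.* y′ ∣
    ≤⟨ ℚ.∣p+q∣≤∣p∣+∣q∣ (ι S ℚ.* y) (ι S′ ℚ.* y′) ⟩
  ℚ.∣ ι S ℚ.* y ∣ ℚ.+ ℚ.∣ ι S′ ℚ.* y′ ∣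
    ≡⟨ cong₂ ℚ._+_ (∣k*p∣≡k*∣p∣ (ι≥0 S) y) (∣k*p∣≡k*∣p∣ (ι≥0 S′) y′) ⟩
  ι S ℚ.* ℚ.∣ y ∣ ℚ.+ ι S′ ℚ.* ℚ.∣ y′ ∣ ∎
  where
  open ℚ.≤-Reasoning
  k : ℤ
  k = + S ℤ.* p ℤ.+ + S′ ℤ.* p′
  y y′ : ℚ
  y  = ι q ℚ.* x ℚ.- fromℤ p
  y′ = ι q′ ℚ.* x ℚ.- fromℤ p′
  lemma : ∀ s s′ q q′ x p p′ → (s ℚ.* q ℚ.+ s′ ℚ.* q′) ℚ.* x ℚ.- (s ℚ.* p ℚ.+ s′ ℚ.* p′) ≡
                               s ℚ.* (q ℚ.* x ℚ.- p) ℚ.+ s′ ℚ.* (q′ ℚ.* x ℚ.- p′)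
  lemma = solve 7 (λ s s′ q q′ x p p′ → (s :* q :+ s′ :* q′) :* x :- (s :* p :+ s′ :* p′) :=
                               s :* (q :* x :- p) :+ s′ :* (q′ :* x :- p′)) refl
    where open +-*-Solver

-- The final bound involves `S` and `S′` but not `w`. With the coefficients coming from a prefix,
-- `κ w` can be forced to be large through `Q` without spoiling the constant.
GoodWord : ℝ → ℕ → ℕ → List ℕ → Set
GoodWord α K Q w =
  All (ℕ._< K) w × Q ℕ.≤ κ w ×
  (∀ S S′ → Eventually λ n →
    ι (κ w) ℚ.* ‖ ι (S ℕ.* κ w ℕ.+ S′ ℕ.* κ′ w) ℚ.* seq α n ‖ℚ ℚ.≤ ι (2 ℕ.* (S ℕ.+ S′)))

good-word : ∀ {K α} → BadWith K α → ∀ Q → 1 ℕ.≤ Q → ∃ (GoodWord α K Q)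
good-word {K} {α} bad Q Q≥1 = w , digits , Q≤q , λ S S′ → N , λ n N≤n → estimate n N≤n S S′
  where
  Q′ : ℕ
  Q′ = suc K ℕ.* Q

  Q′≥1 : 1 ℕ.≤ Q′
  Q′≥1 = ℕ.*-mono-≤ {1} {suc K} (s≤s z≤n) Q≥1

  Q′²>0 : 0ℚ ℚ.< ι (Q′ ℕ.* Q′)
  Q′²>0 = ι>0 (ℕ.*-mono-≤ Q′≥1 Q′≥1)

  bad-up-to : Eventually λ n → ∀ q → q ℕ.≤ Q′ → 1 ℕ.≤ q →
              1ℚ ℚ.≤ ι K ℚ.* (ι q ℚ.* ‖ ι q ℚ.* seq α n ‖ℚ)
  bad-up-to = eventually-∀≤ {λ q n → 1 ℕ.≤ q → _}
    (λ { zero → 0 , λ _ _ () ; (suc q) → eventually-map (λ _ b _ → b) (bad (suc q) (s≤s z≤n)) }) Q′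

  -- The word produced satisfies `κ w ≤ Q′`. An error of `1 / Q′²` in `α`, multiplied by `κ w` and
  -- by some `r ≤ κ w`, therefore costs at most 1.
  close : ∃ λ N → ∀ m n → N ℕ.≤ m → N ℕ.≤ n → ℚ.∣ seq α m ℚ.- seq α n ∣ ℚ.≤ inv (ι (Q′ ℕ.* Q′)) Q′²>0
  close = cauchy α _ (inv>0 (ι (Q′ ℕ.* Q′)) Q′²>0)

  N : ℕ
  N = proj₁ bad-up-to ℕ.⊔ proj₁ close

  x : ℚ
  x = seq α N

  D≥1 : 1 ℕ.≤ ℚ.↧ₙ x
  D≥1 = s≤s z≤n

  open Fraction {x} {ℚ.↥ x} {ℚ.↧ₙ x} D≥1 (numerator x)

  open Euclid (ℚ.↥ x) (ℚ.↧ₙ x) K Q D≥1 Q≥1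
    (λ q p q≥1 q≤ → lower-bound⁻¹ K q q p
      (ℚ.≤-trans (proj₂ bad-up-to N (ℕ.m≤m⊔n _ _) q q≤ q≥1)
        (*-monoʳ-ℚ (ι≥0 K) (*-monoʳ-ℚ (ι≥0 q) (‖p‖≤∣p-k∣ (ι q ℚ.* x) p)))))

  w : List ℕ
  w = proj₁ result

  digits : All (ℕ._< K) w
  digits = proj₁ (proj₂ result)

  Q≤q : Q ℕ.≤ κ w
  Q≤q = proj₁ (proj₂ (proj₂ result))

  q≤Q′ : κ w ℕ.≤ Q′
  q≤Q′ = proj₁ (proj₂ (proj₂ (proj₂ result)))

  module _ (n : ℕ) (N≤n : N ℕ.≤ n) where
    open ℚ.≤-Reasoning

    y : ℚ
    y = seq α n

    Q′²∣y-x∣≤1 : ι (Q′ ℕ.* Q′) ℚ.* ℚ.∣ y ℚ.- x ∣ ℚ.≤ 1ℚ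
    Q′²∣y-x∣≤1 = ℚ.≤-trans
      (*-monoʳ-ℚ (ι≥0 (Q′ ℕ.* Q′)) (proj₂ close n N (ℕ.≤-trans (ℕ.m≤n⊔m _ _) N≤n) (ℕ.m≤n⊔m _ _)))
      (ℚ.≤-reflexive (p*inv (ι (Q′ ℕ.* Q′)) Q′²>0))

    -- One unit comes from the convergent of `x`, the other from replacing `x` by a later term of
    -- `α`; this is the factor 2 in `GoodWord`.
    transfer : ∀ r p → r ℕ.≤ κ w → ι (κ w) ℚ.* ℚ.∣ ι r ℚ.* x ℚ.- fromℤ p ∣ ℚ.≤ 1ℚ →
               ι (κ w) ℚ.* ℚ.∣ ι r ℚ.* y ℚ.- fromℤ p ∣ ℚ.≤ ι 2
    transfer r p r≤q le = begin
      ι q ℚ.* ℚ.∣ ι r ℚ.* y ℚ.- fromℤ p ∣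
        ≤⟨ *-monoʳ-ℚ (ι≥0 q) (∣kx-p∣≤ (ι≥0 r) y x (fromℤ p)) ⟩
      ι q ℚ.* (ℚ.∣ ι r ℚ.* x ℚ.- fromℤ p ∣ ℚ.+ ι r ℚ.* d)
        ≡⟨ ℚ.*-distribˡ-+ (ι q) ℚ.∣ ι r ℚ.* x ℚ.- fromℤ p ∣ (ι r ℚ.* d) ⟩
      ι q ℚ.* ℚ.∣ ι r ℚ.* x ℚ.- fromℤ p ∣ ℚ.+ ι q ℚ.* (ι r ℚ.* d)
        ≡⟨ cong (ι q ℚ.* ℚ.∣ ι r ℚ.* x ℚ.- fromℤ p ∣ ℚ.+_)
             (trans (sym (ℚ.*-assoc (ι q) (ι r) d)) (cong (ℚ._* d) (sym (ι-* q r)))) ⟩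
      ι q ℚ.* ℚ.∣ ι r ℚ.* x ℚ.- fromℤ p ∣ ℚ.+ ι (q ℕ.* r) ℚ.* d
        ≤⟨ ℚ.+-mono-≤ le (ℚ.≤-trans (*-monoˡ-ℚ (ℚ.0≤∣p∣ (y ℚ.- x))
             (ι-mono-≤ (ℕ.*-mono-≤ q≤Q′ (ℕ.≤-trans r≤q q≤Q′)))) Q′²∣y-x∣≤1) ⟩
      1ℚ ℚ.+ 1ℚ ∎
      where
      q : ℕ
      q = κ w
      d : ℚ
      d = ℚ.∣ y ℚ.- x ∣

    estimate : ∀ S S′ → ι (κ w) ℚ.* ‖ ι (S ℕ.* κ w ℕ.+ S′ ℕ.* κ′ w) ℚ.* y ‖ℚ ℚ.≤ ι (2 ℕ.* (S ℕ.+ S′))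
    estimate S S′ = let
        approx = proj₂ (proj₂ (proj₂ (proj₂ result)))
        p  , e  = proj₁ approx
        p′ , e′ = proj₂ approx
        a  = ℚ.∣ ι (κ w) ℚ.* y ℚ.- fromℤ p ∣
        a′ = ℚ.∣ ι (κ′ w) ℚ.* y ℚ.- fromℤ p′ ∣
      in begin
      ι (κ w) ℚ.* ‖ ι (S ℕ.* κ w ℕ.+ S′ ℕ.* κ′ w) ℚ.* y ‖ℚ
        ≤⟨ *-monoʳ-ℚ (ι≥0 (κ w)) (‖lin‖≤ S S′ (κ w) (κ′ w) y p p′) ⟩
      ι (κ w) ℚ.* (ι S ℚ.* a ℚ.+ ι S′ ℚ.* a′)
        ≡⟨ lemma (ι (κ w)) (ι S) (ι S′) a a′ ⟩
      ι S ℚ.* (ι (κ w) ℚ.* a) ℚ.+ ι S′ ℚ.* (ι (κ w) ℚ.* a′)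
        ≤⟨ ℚ.+-mono-≤
             (*-monoʳ-ℚ (ι≥0 S) (transfer (κ w) p ℕ.≤-refl (upper-bound (κ w) (κ w) p e)))
             (*-monoʳ-ℚ (ι≥0 S′) (transfer (κ′ w) p′ (κ′≤κ w) (upper-bound (κ w) (κ′ w) p′ e′))) ⟩
      ι S ℚ.* ι 2 ℚ.+ ι S′ ℚ.* ι 2
        ≡⟨ trans (sym (ι-linear S S′ 2 2)) (cong ι (trans (sym (ℕ.*-distribʳ-+ 2 S S′)) (ℕ.*-comm (S ℕ.+ S′) 2))) ⟩
      ι (2 ℕ.* (S ℕ.+ S′)) ∎
      where
      lemma : ∀ q s s′ a a′ → q ℚ.* (s ℚ.* a ℚ.+ s′ ℚ.* a′) ≡ s ℚ.* (q ℚ.* a) ℚ.+ s′ ℚ.* (q ℚ.* a′)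
      lemma = solve 5 (λ q s s′ a a′ → q :* (s :* a :+ s′ :* a′) := s :* (q :* a) :+ s′ :* (q :* a′)) refl
        where open +-*-Solver

-- Reals up to ≃

≃-refl : ∀ {x} → x ≃ x
≃-refl {x} ε ε>0 = 0 , λ n _ → ℚ.≤-trans
  (ℚ.≤-reflexive (cong ℚ.∣_∣ (ℚ.+-inverseʳ (seq x n)))) (ℚ.<⇒≤ ε>0)

≃-sym : ∀ {x y} → x ≃ y → y ≃ x
≃-sym {x} {y} x≃y ε ε>0 = eventually-map
  (λ n → subst (ℚ._≤ ε) (∣p-q∣≡∣q-p∣ (seq x n) (seq y n))) (x≃y ε ε>0)

p≤∣p∣ : ∀ p → p ℚ.≤ ℚ.∣ p ∣
p≤∣p∣ p with ℚ.≤-total 0ℚ p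
... | inj₁ 0≤p = ℚ.≤-reflexive (sym (ℚ.0≤p⇒∣p∣≡p 0≤p))
... | inj₂ p≤0 = ℚ.≤-trans p≤0 (ℚ.0≤∣p∣ p)

∣p-q∣≤d⇒p≤q+d : ∀ p q {d} → ℚ.∣ p ℚ.- q ∣ ℚ.≤ d → p ℚ.≤ q ℚ.+ d
∣p-q∣≤d⇒p≤q+d p q {d} le = subst (ℚ._≤ q ℚ.+ d) (q+[p-q]≡p p q)
  (ℚ.+-monoʳ-≤ q (ℚ.≤-trans (p≤∣p∣ (p ℚ.- q)) le))

≤-≃-trans : ∀ {x y z} → x ≤ y → y ≃ z → x ≤ z
≤-≃-trans {x} {y} {z} x≤y y≃z ε ε>0 = eventually-map
  (λ n (xy , yz) → begin
    seq x n                              ≤⟨ xy ⟩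
    seq y n ℚ.+ ε/2 ε                    ≤⟨ ℚ.+-monoˡ-≤ (ε/2 ε) (∣p-q∣≤d⇒p≤q+d (seq y n) (seq z n) yz) ⟩
    seq z n ℚ.+ ε/2 ε ℚ.+ ε/2 ε          ≡⟨ ℚ.+-assoc (seq z n) (ε/2 ε) (ε/2 ε) ⟩
    seq z n ℚ.+ (ε/2 ε ℚ.+ ε/2 ε)        ≡⟨ cong (seq z n ℚ.+_) (ε/2+ε/2 ε) ⟩
    seq z n ℚ.+ ε                        ∎)
  (both (x≤y (ε/2 ε) (ε/2-pos ε>0)) (y≃z (ε/2 ε) (ε/2-pos ε>0)))
  where open ℚ.≤-Reasoning

≃-≤-trans : ∀ {x y z} → x ≃ y → y ≤ z → x ≤ z
≃-≤-trans {x} {y} {z} x≃y y≤z ε ε>0 = eventually-map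
  (λ n (xy , yz) → begin
    seq x n                              ≤⟨ ∣p-q∣≤d⇒p≤q+d (seq x n) (seq y n) xy ⟩
    seq y n ℚ.+ ε/2 ε                    ≤⟨ ℚ.+-monoˡ-≤ (ε/2 ε) yz ⟩
    seq z n ℚ.+ ε/2 ε ℚ.+ ε/2 ε          ≡⟨ ℚ.+-assoc (seq z n) (ε/2 ε) (ε/2 ε) ⟩
    seq z n ℚ.+ (ε/2 ε ℚ.+ ε/2 ε)        ≡⟨ cong (seq z n ℚ.+_) (ε/2+ε/2 ε) ⟩
    seq z n ℚ.+ ε                        ∎)
  (both (x≃y (ε/2 ε) (ε/2-pos ε>0)) (y≤z (ε/2 ε) (ε/2-pos ε>0)))
  where open ℚ.≤-Reasoning

‖‖-cong : ∀ {x y} → x ≃ y → ‖ x ‖ ≃ ‖ y ‖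
‖‖-cong {x} {y} x≃y ε ε>0 = eventually-map
  (λ n → ℚ.≤-trans (‖-‖-nonexpansive (seq x n) (seq y n))) (x≃y ε ε>0)

*-congˡ : ∀ {x y z} → y ≃ z → x * y ≃ x * z
*-congˡ {x} {y} {z} y≃z ε ε>0 =
  let K , K>0 , bound = bounded x
      K*i≡1 = p*inv K K>0
      i = inv K K>0
      Kδ≡ε : K ℚ.* (i ℚ.* ε) ≡ ε
      Kδ≡ε = trans (sym (ℚ.*-assoc K i ε)) (trans (cong (ℚ._* ε) K*i≡1) (ℚ.*-identityˡ ε))
  in eventually-map
    (λ n (x≤K , yz) → begin
      ℚ.∣ seq x n ℚ.* seq y n ℚ.- seq x n ℚ.* seq z n ∣
        ≡⟨ cong ℚ.∣_∣ (lemma (seq x n) (seq y n) (seq z n)) ⟩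
      ℚ.∣ seq x n ℚ.* (seq y n ℚ.- seq z n) ∣
        ≡⟨ ℚ.∣p*q∣≡∣p∣*∣q∣ (seq x n) (seq y n ℚ.- seq z n) ⟩
      ℚ.∣ seq x n ∣ ℚ.* ℚ.∣ seq y n ℚ.- seq z n ∣
        ≤⟨ *-mono-ℚ (ℚ.0≤∣p∣ (seq x n)) (ℚ.<⇒≤ (*-pos-ℚ (inv>0 K K>0) ε>0)) x≤K yz ⟩
      K ℚ.* (i ℚ.* ε)
        ≡⟨ Kδ≡ε ⟩
      ε ∎)
    (both bound (y≃z (i ℚ.* ε) (*-pos-ℚ (inv>0 K K>0) ε>0)))
  where
  open ℚ.≤-Reasoning
  lemma : ∀ p q r → p ℚ.* q ℚ.- p ℚ.* r ≡ p ℚ.* (q ℚ.- r)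
  lemma = solve 3 (λ p q r → p :* q :- p :* r := p :* (q :- r)) refl
    where open +-*-Solver

littlewood-cong : ∀ α {β γ} q .{{_ : NonZero q}} → β ≃ γ → littlewood α β q ≃ littlewood α γ q
littlewood-cong α {β} {γ} q β≃γ =
  *-congˡ {fromℕ q * ‖ fromℕ q * α ‖} {‖ fromℕ q * β ‖} {‖ fromℕ q * γ ‖}
    (‖‖-cong {fromℕ q * β} {fromℕ q * γ} (*-congˡ {fromℕ q} {β} {γ} β≃γ))

Bad-resp-≃ : ∀ {β γ} → β ≃ γ → β ∈ Bad → γ ∈ Bad
Bad-resp-≃ {β} {γ} β≃γ (c , c>0 , c≤) = c , c>0 , λ q →
  ≤-≃-trans {c} {fromℕ q * ‖ fromℕ q * β ‖} {fromℕ q * ‖ fromℕ q * γ ‖} (c≤ q)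
    (*-congˡ {fromℕ q} {‖ fromℕ q * β ‖} {‖ fromℕ q * γ ‖}
      (‖‖-cong {fromℕ q * β} {fromℕ q * γ} (*-congˡ {fromℕ q} {β} {γ} β≃γ)))

badWith⇒bad : ∀ {L β} → 1 ℕ.≤ L → BadWith L β → β ∈ Bad
badWith⇒bad {L} {β} L≥1 bad =
  fromℚ i , (i , inv>0 (ι L) L>0 , 0 , λ _ _ → ℚ.≤-reflexive (ℚ.+-identityˡ i)) ,
  λ q ε ε>0 → eventually-map
    (λ n 1≤ → ℚ.≤-trans (i≤ 1≤) (p≤p+ε ε>0)) (bad q (ℕ.>-nonZero⁻¹ q))
  where
  L>0 : 0ℚ ℚ.< ι L
  L>0 = ι>0 L≥1
  i : ℚ
  i = inv (ι L) L>0
  i≤ : ∀ {x} → 1ℚ ℚ.≤ ι L ℚ.* x → i ℚ.≤ x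
  i≤ {x} le = *-cancelʳ-ℚ L>0 (≡.subst₂ ℚ._≤_
    (trans (sym (p*inv (ι L) L>0)) (ℚ.*-comm (ι L) i)) (ℚ.*-comm (ι L) x) le)
  p≤p+ε : ∀ {p ε} → 0ℚ ℚ.< ε → p ℚ.≤ p ℚ.+ ε
  p≤p+ε {p} {ε} ε>0 = subst (ℚ._≤ p ℚ.+ ε) (ℚ.+-identityʳ p) (ℚ.+-monoʳ-≤ p (ℚ.<⇒≤ ε>0))

≤-reciprocal : ∀ {x y} (y>0 : 0ℝ < y) →
  Eventually (λ n → seq x n ℚ.* seq y n ℚ.≤ 1ℚ) → x ≤ 1/[ y ] y>0
≤-reciprocal {x} {y} y>0@(ε₀ , ε₀>0 , ev) xy≤1 ε ε>0 = eventually-map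
  (λ n (xy≤1 , ε₀≤y) → let
      -- The reciprocal is computed from the truncation at `ε₀`, which changes nothing from the
      -- index in `ev` on.
      a = seq y n ℚ.⊔ ε₀
      a>0 = ℚ.<-≤-trans ε₀>0 (ℚ.p≤q⊔p (seq y n) ε₀)
      a≡y = ℚ.p≥q⇒p⊔q≡p (subst (ℚ._≤ seq y n) (ℚ.+-identityˡ ε₀) ε₀≤y)
      x≤i : seq x n ℚ.≤ inv a a>0
      x≤i = *-cancelʳ-ℚ a>0 (≡.subst₂ ℚ._≤_ (cong (seq x n ℚ.*_) (sym a≡y))
              (trans (sym (p*inv a a>0)) (ℚ.*-comm a (inv a a>0))) xy≤1)
    in ℚ.≤-trans x≤i (subst (ℚ._≤ inv a a>0 ℚ.+ ε) (ℚ.+-identityʳ (inv a a>0))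
         (ℚ.+-monoʳ-≤ (inv a a>0) (ℚ.<⇒≤ ε>0))))
  (both xy≤1 ev)

reciprocal≤ : ∀ {y δ} M (y>0 : 0ℝ < y) → 1 ℕ.≤ M → 1ℚ ℚ.≤ ι M ℚ.* δ → fromℕ M < y →
  Eventually λ n → seq (1/[ y ] y>0) n ℚ.≤ δ
reciprocal≤ {y} {δ} M y>0@(ε₀ , ε₀>0 , _) M≥1 1≤Mδ (ε , ε>0 , ev) = eventually-map
  (λ n M+ε≤y → let
      a = seq y n ℚ.⊔ ε₀
      a>0 = ℚ.<-≤-trans ε₀>0 (ℚ.p≤q⊔p (seq y n) ε₀)
      M≤a = ℚ.≤-trans (subst (ℚ._≤ ι M ℚ.+ ε) (ℚ.+-identityʳ (ι M)) (ℚ.+-monoʳ-≤ (ι M) (ℚ.<⇒≤ ε>0)))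
              (ℚ.≤-trans M+ε≤y (ℚ.p≤p⊔q (seq y n) ε₀))
    in *-cancelʳ-ℚ (ι>0 M≥1) (begin
      inv a a>0 ℚ.* ι M  ≤⟨ *-monoʳ-ℚ (ℚ.<⇒≤ (inv>0 a a>0)) M≤a ⟩
      inv a a>0 ℚ.* a    ≡⟨ trans (ℚ.*-comm (inv a a>0) a) (p*inv a a>0) ⟩
      1ℚ                 ≤⟨ 1≤Mδ ⟩
      ι M ℚ.* δ          ≡⟨ ℚ.*-comm (ι M) δ ⟩
      δ ℚ.* ι M          ∎))
  ev
  where open ℚ.≤-Reasoning

-- The infimum of the Littlewood product

‖‖ℚ≥0 : ∀ p → 0ℚ ℚ.≤ ‖ p ‖ℚ
‖‖ℚ≥0 p = ℚ.0≤∣p∣ (p ℚ.- fromℤ (ℚ.round p))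

littlewood≥0 : ∀ α β q .{{_ : NonZero q}} → 0ℝ ≤ littlewood α β q
littlewood≥0 α β q ε ε>0 = 0 , λ n _ → ℚ.+-mono-≤
  (*-nonNeg-ℚ (*-nonNeg-ℚ (ι≥0 q) (‖‖ℚ≥0 (ι q ℚ.* seq α n))) (‖‖ℚ≥0 (ι q ℚ.* seq β n)))
  (ℚ.<⇒≤ ε>0)

infimum-zero : ∀ {φ : Family} (φ>0 : ∀ q .{{_ : NonZero q}} → 0ℝ < φ q) →
  TendsToInfinity (λ q → fromℕ q * φ q) → ∀ α β →
  (Infinitely λ q → littlewood α β q ≤
    1/[ fromℕ q * φ q ] (*-pos {fromℕ q} {φ q} (fromℕ-pos q) (φ>0 q))) →
  IsInfimum (littlewood α β) 0ℝ
infimum-zero {φ} φ>0 qφ→∞ α β inf = (λ q → littlewood≥0 α β q) , below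
  where
  open ℚ.≤-Reasoning
  below : ∀ y → 0ℝ < y → ∃ λ q → ∃ λ (q≢0 : NonZero q) → littlewood α β q {{q≢0}} < y
  below y (ε , ε>0 , ε≤y) =
    -- A quarter of `ε` bounds the reciprocal, another quarter is the error allowed by the real
    -- inequality, and the remaining half witnesses strictness.
    let δ = ε/2 (ε/2 ε)
        δ>0 = ε/2-pos (ε/2-pos ε>0)
        M , M≥1 , 1≤Mδ = archimedean δ>0
        N , large = qφ→∞ (fromℕ M)
        q , q≢0 , N≤q , lw = inf N
    in q , q≢0 , ε/2 ε , ε/2-pos ε>0 , eventually-map
      (λ n ((lw≤ , i≤δ) , ε≤y) → begin
        seq (littlewood α β q {{q≢0}}) n ℚ.+ ε/2 ε
          ≤⟨ ℚ.+-monoˡ-≤ (ε/2 ε) (ℚ.≤-trans lw≤ (ℚ.+-monoˡ-≤ δ i≤δ)) ⟩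
        δ ℚ.+ δ ℚ.+ ε/2 ε    ≡⟨ cong (ℚ._+ ε/2 ε) (ε/2+ε/2 (ε/2 ε)) ⟩
        ε/2 ε ℚ.+ ε/2 ε      ≡⟨ trans (ε/2+ε/2 ε) (sym (ℚ.+-identityˡ ε)) ⟩
        0ℚ ℚ.+ ε             ≤⟨ ε≤y ⟩
        seq y n              ∎)
      (both (both (lw δ δ>0)
        (reciprocal≤ {fromℕ q * φ q {{q≢0}}} {δ} M
          (*-pos {fromℕ q} {φ q {{q≢0}}} (fromℕ-pos q {{q≢0}}) (φ>0 q {{q≢0}}))
          M≥1 1≤Mδ (large q {{q≢0}} N≤q))) ε≤y)

-- Values of words

value : List ℕ → ℚ
value W = fromℤ (+ num W) ℚ.* inv (ι (den W)) (ι>0 (den≥1 W))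

value*den : ∀ W → value W ℚ.* ι (den W) ≡ fromℤ (+ num W)
value*den W = trans (ℚ.*-assoc (ι (num W)) i (ι (den W)))
  (trans (cong (ι (num W) ℚ.*_) (trans (ℚ.*-comm i (ι (den W))) (p*inv (ι (den W)) (ι>0 (den≥1 W)))))
    (ℚ.*-identityʳ (ι (num W))))
  where
  i : ℚ
  i = inv (ι (den W)) (ι>0 (den≥1 W))

module ValueFraction (W : List ℕ) = Fraction {value W} {+ num W} {den W} (den≥1 W) (value*den W)

∣value-value∣ : ∀ U V → ℚ.∣ value U ℚ.- value V ∣ ℚ.* (ι (den U) ℚ.* ι (den V)) ≡
  ι ℤ.∣ + den V ℤ.* + num U ℤ.- + num V ℤ.* + den U ∣
∣value-value∣ U V = begin
  ℚ.∣ x ℚ.- y ∣ ℚ.* (ι (den U) ℚ.* ι (den V))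
    ≡⟨ lemma₁ ℚ.∣ x ℚ.- y ∣ (ι (den U)) (ι (den V)) ⟩
  ι (den V) ℚ.* ℚ.∣ x ℚ.- y ∣ ℚ.* ι (den U)
    ≡⟨ cong (ℚ._* ι (den U)) (∣k*p∣≡k*∣p∣ (ι≥0 (den V)) (x ℚ.- y)) ⟨
  ℚ.∣ ι (den V) ℚ.* (x ℚ.- y) ∣ ℚ.* ι (den U)
    ≡⟨ cong (λ z → ℚ.∣ z ∣ ℚ.* ι (den U)) (lemma₂ (ι (den V)) x y) ⟩
  ℚ.∣ ι (den V) ℚ.* x ℚ.- y ℚ.* ι (den V) ∣ ℚ.* ι (den U)
    ≡⟨ cong (λ z → ℚ.∣ ι (den V) ℚ.* x ℚ.- z ∣ ℚ.* ι (den U)) (value*den V) ⟩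
  ℚ.∣ ι (den V) ℚ.* x ℚ.- fromℤ (+ num V) ∣ ℚ.* ι (den U)
    ≡⟨ ValueFraction.clear-denominator U (den V) (+ num V) ⟩
  ι ℤ.∣ + den V ℤ.* + num U ℤ.- + num V ℤ.* + den U ∣ ∎
  where
  open ≡.≡-Reasoning
  open +-*-Solver
  x y : ℚ
  x = value U
  y = value V
  lemma₁ : ∀ d a b → d ℚ.* (a ℚ.* b) ≡ b ℚ.* d ℚ.* a
  lemma₁ = solve 3 (λ d a b → d :* (a :* b) := b :* d :* a) refl
  lemma₂ : ∀ k x y → k ℚ.* (x ℚ.- y) ≡ k ℚ.* x ℚ.- y ℚ.* k
  lemma₂ = solve 3 (λ k x y → k :* (x :- y) := k :* x :- y :* k) refl

value-close : ∀ U V → ℚ.∣ value (U ++ V) ℚ.- value U ∣ ℚ.* ι (den U ℕ.* den U) ℚ.≤ 1ℚ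
value-close U V = *-cancelʳ-ℚ (ι>0 (den≥1 (U ++ V))) (begin
  d ℚ.* ι (S ℕ.* S) ℚ.* ι D       ≡⟨ cong (λ z → d ℚ.* z ℚ.* ι D) (ι-* S S) ⟩
  d ℚ.* (ι S ℚ.* ι S) ℚ.* ι D     ≡⟨ lemma d (ι S) (ι D) ⟩
  ι S ℚ.* (d ℚ.* (ι D ℚ.* ι S))   ≡⟨ cong (ι S ℚ.*_) (∣value-value∣ (U ++ V) U) ⟩
  ι S ℚ.* ι ℤ.∣ + S ℤ.* + num (U ++ V) ℤ.- + num U ℤ.* + D ∣
                                  ≡⟨ ι-* S _ ⟨
  ι (S ℕ.* ℤ.∣ + S ℤ.* + num (U ++ V) ℤ.- + num U ℤ.* + D ∣)
                                  ≤⟨ ι-mono-≤ (convergent-error U V) ⟩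
  ι D                             ≡⟨ ℚ.*-identityˡ (ι D) ⟨
  1ℚ ℚ.* ι D                      ∎)
  where
  open ℚ.≤-Reasoning
  S D : ℕ
  S = den U
  D = den (U ++ V)
  d : ℚ
  d = ℚ.∣ value (U ++ V) ℚ.- value U ∣
  lemma : ∀ d s e → d ℚ.* (s ℚ.* s) ℚ.* e ≡ s ℚ.* (d ℚ.* (e ℚ.* s))
  lemma = solve 3 (λ d s e → d :* (s :* s) :* e := s :* (d :* (e :* s))) refl
    where open +-*-Solver

-- The factor collects `suc a` from the letter and one unit from each of `κ′ w ≤ κ w` and
-- `den′ W ≤ den W`.
den-∷≤ : ∀ W a w → den (W ++ a ∷ w) ℕ.≤ (3 ℕ.+ a) ℕ.* (den W ℕ.* κ w)
den-∷≤ W a w = begin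
  den (W ++ a ∷ w)                                            ≡⟨ den-++ W (a ∷ w) ⟩
  S ℕ.* (suc a ℕ.* q ℕ.+ κ′ w) ℕ.+ den′ W ℕ.* q
    ≤⟨ ℕ.+-mono-≤ (ℕ.*-monoʳ-≤ S (ℕ.+-monoʳ-≤ (suc a ℕ.* q) (κ′≤κ w))) (ℕ.*-monoˡ-≤ q (den′≤den W)) ⟩
  S ℕ.* (suc a ℕ.* q ℕ.+ q) ℕ.+ S ℕ.* q                       ≡⟨ lemma S a q ⟩
  (3 ℕ.+ a) ℕ.* (S ℕ.* q)                                     ∎
  where
  open ℕ.≤-Reasoning
  S q : ℕ
  S = den W
  q = κ w
  lemma : ∀ s a q → s ℕ.* ((1 ℕ.+ a) ℕ.* q ℕ.+ q) ℕ.+ s ℕ.* q ≡ (3 ℕ.+ a) ℕ.* (s ℕ.* q)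
  lemma = ℕSolver.solve-∀

m≤∣i-j∣ : ∀ i j m → i ℕ.+ m ℕ.≤ j → m ℕ.≤ ℤ.∣ + i ℤ.- + j ∣
m≤∣i-j∣ i j m le = subst (m ℕ.≤_)
  (sym (trans (cong ℤ.∣_∣ (ℤ.m-n≡m⊖n i j)) (ℤ.∣⊖∣-≤ (ℕ.≤-trans (ℕ.m≤m+n i m) le))))
  (ℕ.m+n≤o⇒m≤o∸n m (subst (ℕ._≤ j) (ℕ.+-comm i m) le))

-- The digits 1 and 3 give disjoint cylinders, those of 1 and 2 would touch.
digit-separation : ∀ W v w → let U = W ++ 0 ∷ v ; V = W ++ 2 ∷ w in
  1ℚ ℚ.≤ ℚ.∣ value U ℚ.- value V ∣ ℚ.* ι (15 ℕ.* (den W ℕ.* den W))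
digit-separation W v w = *-cancelʳ-ℚ
  (*-pos-ℚ (ι>0 (den≥1 U)) (ι>0 (den≥1 V))) (begin
  1ℚ ℚ.* (ι (den U) ℚ.* ι (den V))
    ≡⟨ trans (ℚ.*-identityˡ (ι (den U) ℚ.* ι (den V))) (sym (ι-* (den U) (den V))) ⟩
  ι (den U ℕ.* den V)
    ≤⟨ ι-mono-≤ integral ⟩
  ι (15 ℕ.* (S ℕ.* S) ℕ.* C)
    ≡⟨ ι-* (15 ℕ.* (S ℕ.* S)) C ⟩
  ι (15 ℕ.* (S ℕ.* S)) ℚ.* ι C
    ≡⟨ cong (ι (15 ℕ.* (S ℕ.* S)) ℚ.*_) (∣value-value∣ U V) ⟨
  ι (15 ℕ.* (S ℕ.* S)) ℚ.* (d ℚ.* (ι (den U) ℚ.* ι (den V)))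
    ≡⟨ lemma (ι (15 ℕ.* (S ℕ.* S))) d (ι (den U) ℚ.* ι (den V)) ⟩
  d ℚ.* ι (15 ℕ.* (S ℕ.* S)) ℚ.* (ι (den U) ℚ.* ι (den V)) ∎)
  where
  open ℚ.≤-Reasoning
  U V : List ℕ
  U = W ++ 0 ∷ v
  V = W ++ 2 ∷ w
  S C q₀ q₁ r₀ r₁ : ℕ
  S = den W
  C = ℤ.∣ + den V ℤ.* + num U ℤ.- + num V ℤ.* + den U ∣
  q₀ = κ v
  r₀ = κ′ v
  q₁ = κ w
  r₁ = κ′ w
  d : ℚ
  d = ℚ.∣ value U ℚ.- value V ∣
  lemma : ∀ a b c → a ℚ.* (b ℚ.* c) ≡ b ℚ.* a ℚ.* c
  lemma = solve 3 (λ a b c → a :* (b :* c) := b :* a :* c) refl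
    where open +-*-Solver
  C≡ : C ≡ ℤ.∣ det (cont (0 ∷ v)) (cont (2 ∷ w)) ∣
  C≡ = trans (cong (λ z → ℤ.∣ z ℤ.- + num V ℤ.* + den U ∣) (ℤ.*-comm (+ den V) (+ num U)))
    (cross-difference W (0 ∷ v) (2 ∷ w))
  -- The determinant has absolute value `q₀ (3 q₁ + r₁) - (q₀ + r₀) q₁`, and `r₀ ≤ q₀` leaves at
  -- least one product `q₀ q₁`.
  q₀q₁≤C : q₀ ℕ.* q₁ ℕ.≤ C
  q₀q₁≤C = subst (q₀ ℕ.* q₁ ℕ.≤_)
    (trans (cong₂ (λ a b → ℤ.∣ a ℤ.- b ∣) (ℤ.pos-* (1 ℕ.* q₀ ℕ.+ r₀) q₁) (ℤ.pos-* q₀ (3 ℕ.* q₁ ℕ.+ r₁))) (sym C≡))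
    (m≤∣i-j∣ ((1 ℕ.* q₀ ℕ.+ r₀) ℕ.* q₁) (q₀ ℕ.* (3 ℕ.* q₁ ℕ.+ r₁)) (q₀ ℕ.* q₁)
      (≤R (κ′≤κ v)))
    where
    ≤R : r₀ ℕ.≤ q₀ → (1 ℕ.* q₀ ℕ.+ r₀) ℕ.* q₁ ℕ.+ q₀ ℕ.* q₁ ℕ.≤ q₀ ℕ.* (3 ℕ.* q₁ ℕ.+ r₁)
    ≤R le = ℕ.≤-trans (ℕ.+-monoˡ-≤ (q₀ ℕ.* q₁) (ℕ.*-monoˡ-≤ q₁ (ℕ.+-monoʳ-≤ (1 ℕ.* q₀) le)))
      (ℕ.≤-trans (ℕ.≤-reflexive (eq q₀ q₁)) (ℕ.*-monoʳ-≤ q₀ (ℕ.m≤m+n (3 ℕ.* q₁) r₁)))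
      where
      eq : ∀ q r → (1 ℕ.* q ℕ.+ q) ℕ.* r ℕ.+ q ℕ.* r ≡ q ℕ.* (3 ℕ.* r)
      eq = ℕSolver.solve-∀
  -- The constant 15 is the product of the factors 3 and 5 that `den-∷≤` gives for the letters 0 and
  -- 2.
  integral : den U ℕ.* den V ℕ.≤ 15 ℕ.* (S ℕ.* S) ℕ.* C
  integral = ℕ.≤-trans (ℕ.*-mono-≤ (den-∷≤ W 0 v) (den-∷≤ W 2 w))
    (ℕ.≤-trans (ℕ.≤-reflexive (eq S q₀ q₁)) (ℕ.*-monoʳ-≤ (15 ℕ.* (S ℕ.* S)) q₀q₁≤C))
    where
    eq : ∀ s q r → (3 ℕ.+ 0) ℕ.* (s ℕ.* q) ℕ.* ((3 ℕ.+ 2) ℕ.* (s ℕ.* r)) ≡ 15 ℕ.* (s ℕ.* s) ℕ.* (q ℕ.* r)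
    eq = ℕSolver.solve-∀

value-close-≤ : ∀ {u} U V M → ι M ℚ.* u ≡ 1ℚ → 1 ℕ.≤ M → M ℕ.≤ den U ℕ.* den U →
                ℚ.∣ value (U ++ V) ℚ.- value U ∣ ℚ.≤ u
value-close-≤ {u} U V M Mu≡1 M≥1 M≤ = *-cancelʳ-ℚ (ι>0 M≥1) (begin
  ℚ.∣ value (U ++ V) ℚ.- value U ∣ ℚ.* ι M
    ≤⟨ *-monoʳ-ℚ (ℚ.0≤∣p∣ (value (U ++ V) ℚ.- value U)) (ι-mono-≤ M≤) ⟩
  ℚ.∣ value (U ++ V) ℚ.- value U ∣ ℚ.* ι (den U ℕ.* den U)  ≤⟨ value-close U V ⟩
  1ℚ                                                        ≡⟨ trans (ℚ.*-comm u (ι M)) Mu≡1 ⟨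
  u ℚ.* ι M                                                 ∎)
  where open ℚ.≤-Reasoning

value-bad : ∀ {K} W → All (ℕ._< K) W → ∀ q → 1 ℕ.≤ q → 2 ℕ.* q ℕ.≤ den W → ∀ V →
  1ℚ ℚ.≤ ι (4 ℕ.* suc K) ℚ.* (ι q ℚ.* ‖ ι q ℚ.* value (W ++ V) ‖ℚ)
value-bad {K} W ds q q≥1 2q≤ V = ValueFraction.lower-bound (W ++ V) (4 ℕ.* suc K) q q p
  (bounded-digits⇒bad {K} W ds q p q≥1 2q≤ V)
  where
  p : ℤ
  p = ℚ.round (ι q ℚ.* value (W ++ V))

digit : Bool → ℕ
digit false = 0
digit true  = 2

digit<3 : ∀ b → digit b ℕ.< 3
digit<3 false = s≤s z≤n
digit<3 true  = ℕ.≤-refl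

separated : ∀ {u r x y z} → 0ℚ ℚ.≤ u → (u ℚ.+ u) ℚ.+ (u ℚ.+ u) ℚ.≤ x ℚ.- r →
            y ℚ.≤ r ℚ.+ u → x ℚ.≤ z ℚ.+ u → y ℚ.+ u ℚ.≤ z
separated {u} {r} {x} {y} {z} u≥0 gap y≤ x≤ = begin
  y ℚ.+ u                                                        ≤⟨ ℚ.+-monoˡ-≤ u y≤ ⟩
  r ℚ.+ u ℚ.+ u                                                  ≡⟨ ℚ.+-identityʳ (r ℚ.+ u ℚ.+ u) ⟨
  r ℚ.+ u ℚ.+ u ℚ.+ 0ℚ                                           ≤⟨ ℚ.+-monoʳ-≤ (r ℚ.+ u ℚ.+ u) u≥0 ⟩
  r ℚ.+ u ℚ.+ u ℚ.+ u                                            ≡⟨ lemma₁ r u ⟩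
  r ℚ.+ ((u ℚ.+ u) ℚ.+ (u ℚ.+ u)) ℚ.- u                          ≤⟨ ℚ.+-monoˡ-≤ (ℚ.- u) (ℚ.+-monoʳ-≤ r gap) ⟩
  r ℚ.+ (x ℚ.- r) ℚ.- u                                          ≡⟨ cong (ℚ._- u) (q+[p-q]≡p x r) ⟩
  x ℚ.- u                                                        ≤⟨ ℚ.+-monoˡ-≤ (ℚ.- u) x≤ ⟩
  z ℚ.+ u ℚ.- u                                                  ≡⟨ lemma₂ z u ⟩
  z                                                              ∎
  where
  open ℚ.≤-Reasoning
  open +-*-Solver
  lemma₁ : ∀ r u → r ℚ.+ u ℚ.+ u ℚ.+ u ≡ r ℚ.+ ((u ℚ.+ u) ℚ.+ (u ℚ.+ u)) ℚ.- u
  lemma₁ = solve 2 (λ r u → r :+ u :+ u :+ u := r :+ ((u :+ u) :+ (u :+ u)) :- u) refl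
  lemma₂ : ∀ z u → z ℚ.+ u ℚ.- u ≡ z
  lemma₂ = solve 2 (λ z u → z :+ u :- u := z) refl

rescale : ∀ {q T c A} → 0ℚ ℚ.≤ A → q ℕ.≤ T ℕ.* c → ι c ℚ.* A ℚ.≤ ι T →
          ι q ℚ.* A ℚ.≤ ι (T ℕ.* T)
rescale {q} {T} {c} {A} A≥0 q≤Tc cA≤T = begin
  ι q ℚ.* A            ≤⟨ *-monoˡ-ℚ A≥0 (ι-mono-≤ q≤Tc) ⟩
  ι (T ℕ.* c) ℚ.* A    ≡⟨ trans (cong (ℚ._* A) (ι-* T c)) (ℚ.*-assoc (ι T) (ι c) A) ⟩
  ι T ℚ.* (ι c ℚ.* A)  ≤⟨ *-monoʳ-ℚ (ι≥0 T) cA≤T ⟩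
  ι T ℚ.* ι T          ≡⟨ ι-* T T ⟨
  ι (T ℕ.* T)          ∎
  where open ℚ.≤-Reasoning

-- Multiplied by `q f`, the left side regroups as `q‖qα‖ · q‖qβ‖ · f`: each distance takes one of
-- the two factors `q`, and `f` absorbs the constant `M`.
littlewood-bound : ∀ {f} α β q .{{_ : NonZero q}} M (f>0 : 0ℝ < f) →
  (Eventually λ n → ι q ℚ.* ‖ ι q ℚ.* seq α n ‖ℚ ℚ.≤ ι M) →
  (Eventually λ n → ι q ℚ.* ‖ ι q ℚ.* seq β n ‖ℚ ℚ.≤ 1ℚ) →
  (Eventually λ n → ι M ℚ.* seq f n ℚ.≤ 1ℚ) →
  littlewood α β q ≤ 1/[ fromℕ q * f ] (*-pos {fromℕ q} {f} (fromℕ-pos q) f>0)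
littlewood-bound {f} α β q M f>0@(ε , ε>0 , ε≤f) α≤ β≤ f≤ =
  ≤-reciprocal {littlewood α β q} {fromℕ q * f} (*-pos {fromℕ q} {f} (fromℕ-pos q) f>0)
    (eventually-map (λ n ((A≤ , B≤) , (F≤ , ε≤F)) → estimate
        (‖‖ℚ≥0 (ι q ℚ.* seq α n))
        (ℚ.≤-trans (ℚ.<⇒≤ ε>0) (subst (ℚ._≤ seq f n) (ℚ.+-identityˡ ε) ε≤F)) A≤ B≤ F≤)
      (both (both α≤ β≤) (both f≤ ε≤f)))
  where
  open ℚ.≤-Reasoning
  lemma : ∀ q a b f → q ℚ.* a ℚ.* b ℚ.* (q ℚ.* f) ≡ q ℚ.* a ℚ.* (q ℚ.* b) ℚ.* f
  lemma = solve 4 (λ q a b f → q :* a :* b :* (q :* f) := q :* a :* (q :* b) :* f) refl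
    where open +-*-Solver
  estimate : ∀ {A B F} → 0ℚ ℚ.≤ A → 0ℚ ℚ.≤ F →
    ι q ℚ.* A ℚ.≤ ι M → ι q ℚ.* B ℚ.≤ 1ℚ → ι M ℚ.* F ℚ.≤ 1ℚ →
    ι q ℚ.* A ℚ.* B ℚ.* (ι q ℚ.* F) ℚ.≤ 1ℚ
  estimate {A} {B} {F} A≥0 F≥0 A≤ B≤ F≤ = begin
    ι q ℚ.* A ℚ.* B ℚ.* (ι q ℚ.* F)    ≡⟨ lemma (ι q) A B F ⟩
    ι q ℚ.* A ℚ.* (ι q ℚ.* B) ℚ.* F
      ≤⟨ *-monoˡ-ℚ F≥0 (*-mono-ℚ (*-nonNeg-ℚ (ι≥0 q) A≥0) (ℚ.<⇒≤ (ℚ.positive⁻¹ 1ℚ)) A≤ B≤) ⟩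
    ι M ℚ.* 1ℚ ℚ.* F                   ≡⟨ cong (ℚ._* F) (ℚ.*-identityʳ (ι M)) ⟩
    ι M ℚ.* F                          ≤⟨ F≤ ⟩
    1ℚ                                 ∎

-- A rational approximation of y cannot lie within 4u of both centres, so testing one
-- of them decides which family to use.
module _ {I : Set} (z : Bool → I → ℚ) (x : Bool → ℚ) {u} (u>0 : 0ℚ ℚ.< u)
  (far : ((u ℚ.+ u) ℚ.+ (u ℚ.+ u)) ℚ.+ ((u ℚ.+ u) ℚ.+ (u ℚ.+ u)) ℚ.≤ ℚ.∣ x false ℚ.- x true ∣)
  (radius : ∀ b i → ℚ.∣ z b i ℚ.- x b ∣ ℚ.≤ u) (y : ℝ) where
  open ℚ.≤-Reasoning

  Avoids : Bool → Set
  Avoids b = ∃ λ N →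
    (∀ n → N ℕ.≤ n → ∀ i → z b i ℚ.+ u ℚ.≤ seq y n) ⊎
    (∀ n → N ℕ.≤ n → ∀ i → seq y n ℚ.+ u ℚ.≤ z b i)

  private
    N : ℕ
    N = proj₁ (cauchy y u u>0)
    r u4 : ℚ
    r = seq y N
    u4 = (u ℚ.+ u) ℚ.+ (u ℚ.+ u)

  y-close : ∀ n → N ℕ.≤ n → ℚ.∣ seq y n ℚ.- r ∣ ℚ.≤ u
  y-close n N≤n = proj₂ (cauchy y u u>0) n N N≤n ℕ.≤-refl

  flip : ∀ {p q} → ℚ.∣ p ℚ.- q ∣ ℚ.≤ u → ℚ.∣ q ℚ.- p ∣ ℚ.≤ u
  flip {p} {q} = subst (ℚ._≤ u) (∣p-q∣≡∣q-p∣ p q)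

  apart : ∀ b → u4 ℚ.≤ ℚ.∣ x b ℚ.- r ∣ → Avoids b
  apart b gap with ℚ.∣p∣≡p∨∣p∣≡-p (x b ℚ.- r)
  ... | inj₁ eq = N , inj₂ λ n N≤n i →
    separated {u} {r} {x b} {seq y n} {z b i} (ℚ.<⇒≤ u>0) (subst (u4 ℚ.≤_) eq gap)
      (∣p-q∣≤d⇒p≤q+d (seq y n) r (y-close n N≤n))
      (∣p-q∣≤d⇒p≤q+d (x b) (z b i) (flip {z b i} {x b} (radius b i)))
  ... | inj₂ eq = N , inj₁ λ n N≤n i →
    separated {u} {x b} {r} {z b i} {seq y n} (ℚ.<⇒≤ u>0)
      (subst (u4 ℚ.≤_) (trans eq (-[p-q]≡q-p (x b) r)) gap)
      (∣p-q∣≤d⇒p≤q+d (z b i) (x b) (radius b i))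
      (∣p-q∣≤d⇒p≤q+d r (seq y n) (flip {seq y n} {r} (y-close n N≤n)))

  choose : u4 ℚ.≤ ℚ.∣ x false ℚ.- r ∣ ⊎ ℚ.∣ x false ℚ.- r ∣ ℚ.≤ u4 → ∃ Avoids
  choose (inj₁ gap)  = false , apart false gap
  choose (inj₂ near) = true , apart true (begin
    u4                                     ≡⟨ [q+d]-q≡d u4 u4 ⟨
    u4 ℚ.+ u4 ℚ.- u4                       ≤⟨ ℚ.+-monoˡ-≤ (ℚ.- u4) (ℚ.≤-trans far
                                                (ℚ.≤-trans (∣p-r∣≤∣p-q∣+∣q-r∣ (x false) r (x true))
                                                  (ℚ.+-monoˡ-≤ ℚ.∣ r ℚ.- x true ∣ near))) ⟩
    u4 ℚ.+ ℚ.∣ r ℚ.- x true ∣ ℚ.- u4       ≡⟨ [q+d]-q≡d u4 ℚ.∣ r ℚ.- x true ∣ ⟩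
    ℚ.∣ r ℚ.- x true ∣                     ≡⟨ ∣p-q∣≡∣q-p∣ r (x true) ⟩
    ℚ.∣ x true ℚ.- r ∣                     ∎)

  avoid : ∃ Avoids
  avoid = choose (ℚ.≤-total u4 ℚ.∣ x false ℚ.- r ∣)

eight-units : ∀ {u d m} → 1 ℕ.≤ m → ι (8 ℕ.* m) ℚ.* u ≡ 1ℚ → 1ℚ ℚ.≤ d ℚ.* ι m →
  ((u ℚ.+ u) ℚ.+ (u ℚ.+ u)) ℚ.+ ((u ℚ.+ u) ℚ.+ (u ℚ.+ u)) ℚ.≤ d
eight-units {u} {d} {m} m≥1 8mu≡1 1≤dm = *-cancelʳ-ℚ (ι>0 m≥1) (begin
  (((u ℚ.+ u) ℚ.+ (u ℚ.+ u)) ℚ.+ ((u ℚ.+ u) ℚ.+ (u ℚ.+ u))) ℚ.* ι m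
                         ≡⟨ lemma u (ι m) ⟩
  ι 8 ℚ.* ι m ℚ.* u      ≡⟨ cong (ℚ._* u) (ι-* 8 m) ⟨
  ι (8 ℕ.* m) ℚ.* u      ≡⟨ 8mu≡1 ⟩
  1ℚ                     ≤⟨ 1≤dm ⟩
  d ℚ.* ι m              ∎)
  where
  open ℚ.≤-Reasoning
  lemma : ∀ u m → (((u ℚ.+ u) ℚ.+ (u ℚ.+ u)) ℚ.+ ((u ℚ.+ u) ℚ.+ (u ℚ.+ u))) ℚ.* m ≡ ι 8 ℚ.* m ℚ.* u
  lemma = solve 2 (λ u m → (((u :+ u) :+ (u :+ u)) :+ ((u :+ u) :+ (u :+ u))) :* m :=
                           con (ι 8) :* m :* u) refl
    where open +-*-Solver

-- This is the origin of 11, the least integer whose square is at least 8 · 15: 15 comes from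
-- `digit-separation`, and 8 is the ratio of distance to radius that `avoid` asks for.
120s²≤ : ∀ {s t} → 11 ℕ.* s ℕ.≤ t → 8 ℕ.* (15 ℕ.* (s ℕ.* s)) ℕ.≤ t ℕ.* t
120s²≤ {s} {t} 11s≤t = begin
  8 ℕ.* (15 ℕ.* (s ℕ.* s))            ≤⟨ ℕ.m≤m+n (8 ℕ.* (15 ℕ.* (s ℕ.* s))) (s ℕ.* s) ⟩
  8 ℕ.* (15 ℕ.* (s ℕ.* s)) ℕ.+ s ℕ.* s ≡⟨ lemma s ⟩
  11 ℕ.* s ℕ.* (11 ℕ.* s)             ≤⟨ ℕ.*-mono-≤ 11s≤t 11s≤t ⟩
  t ℕ.* t                             ∎
  where
  open ℕ.≤-Reasoning
  lemma : ∀ s → 8 ℕ.* (15 ℕ.* (s ℕ.* s)) ℕ.+ s ℕ.* s ≡ 11 ℕ.* s ℕ.* (11 ℕ.* s)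
  lemma = ℕSolver.solve-∀

-- The binary tree of expansions

module Construction
  (φ : Family) (φ>0 : ∀ q .{{_ : NonZero q}} → 0ℝ < φ q) (φ→0 : ConvergesTo φ 0ℝ)
  {K : ℕ} {α : ℝ} (α-bad : BadWith K α)
  where

  abstract
    φ-small : ∀ M → 1 ℕ.≤ M → ∃ λ N → ∀ q .{{_ : NonZero q}} → N ℕ.≤ q →
              Eventually λ n → ι M ℚ.* seq (φ q) n ℚ.≤ 1ℚ
    φ-small M M≥1 =
      let i = inv (ι M) (ι>0 M≥1)
          i>0 = inv>0 (ι M) (ι>0 M≥1)
          N , close = φ→0 (fromℚ i)
            (i , i>0 , 0 , λ _ _ → ℚ.≤-reflexive (ℚ.+-identityˡ i))
      in N , λ q N≤q → let δ , δ>0 , ev = close q N≤q in eventually-map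
        (λ n ∣φ∣+δ≤i → begin
          ι M ℚ.* seq (φ q) n
            ≤⟨ *-monoʳ-ℚ (ι≥0 M) (begin
                 seq (φ q) n                     ≡⟨ ℚ.+-identityʳ (seq (φ q) n) ⟨
                 seq (φ q) n ℚ.- 0ℚ              ≤⟨ p≤∣p∣ (seq (φ q) n ℚ.- 0ℚ) ⟩
                 ℚ.∣ seq (φ q) n ℚ.- 0ℚ ∣        ≡⟨ ℚ.+-identityʳ ℚ.∣ seq (φ q) n ℚ.- 0ℚ ∣ ⟨
                 ℚ.∣ seq (φ q) n ℚ.- 0ℚ ∣ ℚ.+ 0ℚ ≤⟨ ℚ.+-monoʳ-≤ ℚ.∣ seq (φ q) n ℚ.- 0ℚ ∣ (ℚ.<⇒≤ δ>0) ⟩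
                 ℚ.∣ seq (φ q) n ℚ.- 0ℚ ∣ ℚ.+ δ  ≤⟨ ∣φ∣+δ≤i ⟩
                 i                               ∎) ⟩
          ι M ℚ.* i  ≡⟨ p*inv (ι M) (ι>0 M≥1) ⟩
          1ℚ         ∎) ev
      where open ℚ.≤-Reasoning

  module Stage (W : List ℕ) (b : Bool) where
    U : List ℕ
    U = W ++ digit b ∷ []

    -- This is the constant in `GoodWord` for the coefficients with which `κ w` and `κ′ w` enter the
    -- denominator of `U ++ w`.
    T : ℕ
    T = 2 ℕ.* (den U ℕ.+ den′ U)

    T≥1 : 1 ℕ.≤ T
    T≥1 = ℕ.*-mono-≤ {1} {2} (s≤s z≤n) (ℕ.≤-trans (den≥1 U) (ℕ.m≤m+n _ _))

    small : ∃ λ N → ∀ q .{{_ : NonZero q}} → N ℕ.≤ q →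
            Eventually λ n → ι (T ℕ.* T) ℚ.* seq (φ q) n ℚ.≤ 1ℚ
    small = φ-small (T ℕ.* T) (ℕ.*-mono-≤ T≥1 T≥1)

    -- The 11 makes the next cylinder narrow enough for the separation; the threshold makes `φ` at
    -- most `1 / T²` from there on.
    Q : ℕ
    Q = 11 ℕ.⊔ proj₁ small

    abstract
      good : ∃ (GoodWord α K Q)
      good = good-word {K} {α} α-bad Q (ℕ.≤-trans (s≤s z≤n) (ℕ.m≤m⊔n 11 (proj₁ small)))

    w : List ℕ
    w = proj₁ good

    digits : All (ℕ._< K) w
    digits = proj₁ (proj₂ good)

    Q≤q : Q ℕ.≤ κ w
    Q≤q = proj₁ (proj₂ (proj₂ good))

    next : List ℕ
    next = W ++ digit b ∷ w

    next≡ : next ≡ U ++ w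
    next≡ = sym (++-assoc W (digit b ∷ []) w)

    11*den≤den : 11 ℕ.* den W ℕ.≤ den next
    11*den≤den = begin
      11 ℕ.* den W       ≡⟨ ℕ.*-comm 11 (den W) ⟩
      den W ℕ.* 11       ≤⟨ ℕ.*-mono-≤ (den-mono W (digit b ∷ []))
                              (ℕ.≤-trans (ℕ.m≤m⊔n 11 (proj₁ small)) Q≤q) ⟩
      den U ℕ.* κ w     ≤⟨ den*κ≤den U w ⟩
      den (U ++ w)       ≡⟨ cong den next≡ ⟨
      den next           ∎
      where open ℕ.≤-Reasoning

    q : ℕ
    q = den next

    q≡ : q ≡ den U ℕ.* κ w ℕ.+ den′ U ℕ.* κ′ w
    q≡ = trans (cong den next≡) (den-++ U w)

    instance
      q≢0 : NonZero q
      q≢0 = ℕ.>-nonZero (den≥1 next)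

    threshold≤q : proj₁ small ℕ.≤ q
    threshold≤q = begin
      proj₁ small      ≤⟨ ℕ.m≤n⊔m 11 (proj₁ small) ⟩
      Q                ≤⟨ Q≤q ⟩
      κ w             ≡⟨ ℕ.*-identityˡ (κ w) ⟨
      1 ℕ.* κ w       ≤⟨ ℕ.*-monoˡ-≤ (κ w) (den≥1 U) ⟩
      den U ℕ.* κ w   ≤⟨ ℕ.m≤m+n _ _ ⟩
      den U ℕ.* κ w ℕ.+ den′ U ℕ.* κ′ w ≡⟨ q≡ ⟨
      q                ∎
      where open ℕ.≤-Reasoning

    q≤T*κ : q ℕ.≤ T ℕ.* κ w
    q≤T*κ = begin
      q                                    ≡⟨ q≡ ⟩
      den U ℕ.* κ w ℕ.+ den′ U ℕ.* κ′ w   ≤⟨ ℕ.+-monoʳ-≤ (den U ℕ.* κ w) (ℕ.*-monoʳ-≤ (den′ U) (κ′≤κ w)) ⟩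
      den U ℕ.* κ w ℕ.+ den′ U ℕ.* κ w   ≡⟨ ℕ.*-distribʳ-+ (κ w) (den U) (den′ U) ⟨
      (den U ℕ.+ den′ U) ℕ.* κ w          ≤⟨ ℕ.*-monoˡ-≤ (κ w) (ℕ.m≤m+n (den U ℕ.+ den′ U) _) ⟩
      T ℕ.* κ w                           ∎
      where open ℕ.≤-Reasoning

    -- One factor `T` is the bound on `κ w · ‖qα‖` from `GoodWord`, the other comes from
    -- `q ≤ T · κ w`.
    q‖qα‖≤T² : Eventually λ n → ι q ℚ.* ‖ ι q ℚ.* seq α n ‖ℚ ℚ.≤ ι (T ℕ.* T)
    q‖qα‖≤T² = eventually-map
      (λ n le → rescale {q} {T} {κ w} (‖‖ℚ≥0 (ι q ℚ.* seq α n)) q≤T*κ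
        (subst (λ q → ι (κ w) ℚ.* ‖ ι q ℚ.* seq α n ‖ℚ ℚ.≤ ι T) (sym q≡) le))
      (proj₂ (proj₂ (proj₂ good)) (den U) (den′ U))

    q‖qβ‖≤1 : ∀ V → ι q ℚ.* ‖ ι q ℚ.* value (next ++ V) ‖ℚ ℚ.≤ 1ℚ
    q‖qβ‖≤1 V = ℚ.≤-trans
      (*-monoʳ-ℚ (ι≥0 q) (‖p‖≤∣p-k∣ (ι q ℚ.* value (next ++ V)) (+ num next)))
      (ValueFraction.upper-bound (next ++ V) q q (+ num next) (convergent-error next V))

    littlewood≤ : ∀ β → Eventually (λ n → ∃ λ V → seq β n ≡ value (next ++ V)) →
      littlewood α β q ≤ 1/[ fromℕ q * φ q ] (*-pos {fromℕ q} {φ q} (fromℕ-pos q) (φ>0 q))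
    littlewood≤ β β∈next = littlewood-bound {φ q} α β q (T ℕ.* T) (φ>0 q) q‖qα‖≤T²
      (eventually-map (λ { n (V , β≡) →
        subst (λ x → ι q ℚ.* ‖ ι q ℚ.* x ‖ℚ ℚ.≤ 1ℚ) (sym β≡) (q‖qβ‖≤1 V) }) β∈next)
      (proj₂ small q threshold≤q)

  open Stage using (next)

  words : (ℕ → Bool) → ℕ → List ℕ
  words s zero    = []
  words s (suc j) = next (words s j) (s j)

  words-digits : ∀ s j → All (ℕ._< K ℕ.⊔ 3) (words s j)
  words-digits s zero    = []
  words-digits s (suc j) = All.++⁺ (words-digits s j)
    (ℕ.≤-trans (digit<3 (s j)) (ℕ.m≤n⊔m K 3) ∷
     All.map (λ a<K → ℕ.≤-trans a<K (ℕ.m≤m⊔n K 3)) (Stage.digits (words s j) (s j)))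

  words-extend : ∀ s j {n} → j ℕ.≤ n → ∃ λ V → words s n ≡ words s j ++ V
  words-extend s j {n} j≤n = subst (λ n → ∃ λ V → words s n ≡ words s j ++ V) (ℕ.m∸n+n≡m j≤n) (go (n ℕ.∸ j))
    where
    go : ∀ k → ∃ λ V → words s (k ℕ.+ j) ≡ words s j ++ V
    go zero    = [] , sym (++-identityʳ (words s j))
    go (suc k) = let V , eq = go k ; W = words s (k ℕ.+ j) ; b = s (k ℕ.+ j) ; w = digit b ∷ Stage.w W b in
      V ++ w , trans (cong (_++ w) eq) (++-assoc (words s j) V w)

  -- This linear growth provides the modulus of convergence, a prefix long enough to test badness at
  -- a given `q`, and arbitrarily large solutions `q`.
  den-words : ∀ s j → suc j ℕ.≤ den (words s j)
  den-words s zero    = s≤s z≤n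
  den-words s (suc j) = begin
    suc (suc j)            ≤⟨ s≤s (den-words s j) ⟩
    1 ℕ.+ den W            ≤⟨ ℕ.+-monoˡ-≤ (den W) (den≥1 W) ⟩
    den W ℕ.+ den W        ≤⟨ ℕ.+-monoʳ-≤ (den W) (ℕ.m≤m+n (den W) (9 ℕ.* den W)) ⟩
    11 ℕ.* den W           ≤⟨ Stage.11*den≤den W (s j) ⟩
    den (words s (suc j))  ∎
    where
    open ℕ.≤-Reasoning
    W : List ℕ
    W = words s j

  words-close : ∀ s j {n δ} → 0ℚ ℚ.< δ → j ℕ.≤ n → 1ℚ ℚ.≤ ι j ℚ.* δ →
    ℚ.∣ value (words s n) ℚ.- value (words s j) ∣ ℚ.≤ δ
  words-close s j {n} {δ} δ>0 j≤n 1≤jδ with words-extend s j j≤n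
  ... | V , eq = subst (λ z → ℚ.∣ value z ℚ.- value W ∣ ℚ.≤ δ) (sym eq)
    (*-cancelʳ-ℚ (ι>0 (ℕ.*-mono-≤ (den≥1 W) (den≥1 W))) (begin
      ℚ.∣ value (W ++ V) ℚ.- value W ∣ ℚ.* ι (S ℕ.* S) ≤⟨ value-close W V ⟩
      1ℚ                ≤⟨ 1≤jδ ⟩
      ι j ℚ.* δ         ≤⟨ *-monoˡ-ℚ (ℚ.<⇒≤ δ>0) (ι-mono-≤ (ℕ.≤-trans j≤S (ℕ.m≤m*n S S {{ℕ.>-nonZero (den≥1 W)}}))) ⟩
      ι (S ℕ.* S) ℚ.* δ ≡⟨ ℚ.*-comm (ι (S ℕ.* S)) δ ⟩
      δ ℚ.* ι (S ℕ.* S) ∎))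
    where
    open ℚ.≤-Reasoning
    W : List ℕ
    W = words s j
    S : ℕ
    S = den W
    j≤S : j ℕ.≤ S
    j≤S = ℕ.≤-trans (ℕ.n≤1+n j) (den-words s j)

  limit : (ℕ → Bool) → ℝ
  seq    (limit s) n = value (words s n)
  cauchy (limit s) ε ε>0 =
    let j , _ , 1≤jδ = archimedean (ε/2-pos ε>0)
        x = λ n → value (words s n)
    in j , λ m n j≤m j≤n → begin
      ℚ.∣ x m ℚ.- x n ∣                        ≤⟨ ∣p-r∣≤∣p-q∣+∣q-r∣ (x m) (x j) (x n) ⟩
      ℚ.∣ x m ℚ.- x j ∣ ℚ.+ ℚ.∣ x j ℚ.- x n ∣  ≡⟨ cong (ℚ.∣ x m ℚ.- x j ∣ ℚ.+_) (∣p-q∣≡∣q-p∣ (x j) (x n)) ⟩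
      ℚ.∣ x m ℚ.- x j ∣ ℚ.+ ℚ.∣ x n ℚ.- x j ∣
        ≤⟨ ℚ.+-mono-≤ (words-close s j (ε/2-pos ε>0) j≤m 1≤jδ) (words-close s j (ε/2-pos ε>0) j≤n 1≤jδ) ⟩
      ε/2 ε ℚ.+ ε/2 ε                          ≡⟨ ε/2+ε/2 ε ⟩
      ε                                        ∎
    where open ℚ.≤-Reasoning

  words-cong : ∀ {s t} → s ≗ t → ∀ j → words s j ≡ words t j
  words-cong s≗t zero    = refl
  words-cong s≗t (suc j) = cong₂ next (words-cong s≗t j) (s≗t j)

  limit-cong : ∀ {s t} → s ≗ t → limit s ≃ limit t
  limit-cong {s} {t} s≗t ε ε>0 = 0 , λ n _ →
    subst (λ W → ℚ.∣ value (words s n) ℚ.- value W ∣ ℚ.≤ ε) (words-cong s≗t n)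
      (ℚ.≤-trans (ℚ.≤-reflexive (cong ℚ.∣_∣ (ℚ.+-inverseʳ (value (words s n))))) (ℚ.<⇒≤ ε>0))

  limit-bad : ∀ s → limit s ∈ Bad
  -- From index `2q` on, all terms share a prefix with denominator above `2q`, as `value-bad`
  -- requires. The letters are below `K` or are the free letters 0 and 2, hence `K ⊔ 3`.
  limit-bad s = badWith⇒bad {4 ℕ.* suc (K ℕ.⊔ 3)} {limit s} (s≤s z≤n) λ q q≥1 → 2 ℕ.* q , λ n le →
    let V , eq = words-extend s (2 ℕ.* q) le in
    subst (λ z → 1ℚ ℚ.≤ ι (4 ℕ.* suc (K ℕ.⊔ 3)) ℚ.* (ι q ℚ.* ‖ ι q ℚ.* value z ‖ℚ)) (sym eq)
      (value-bad {K ℕ.⊔ 3} (words s (2 ℕ.* q)) (words-digits s (2 ℕ.* q)) q q≥1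
        (ℕ.≤-trans (ℕ.n≤1+n _) (den-words s (2 ℕ.* q))) V)

  limit-littlewood : ∀ s → Infinitely λ q → littlewood α (limit s) q ≤
    1/[ fromℕ q * φ q ] (*-pos {fromℕ q} {φ q} (fromℕ-pos q) (φ>0 q))
  limit-littlewood s N = den (words s (suc N)) , q≢0 ,
    ℕ.≤-trans (ℕ.m≤n+m N 2) (den-words s (suc N)) ,
    littlewood≤ (limit s) (suc N , λ n le →
      let V , eq = words-extend s (suc N) le in V , cong value eq)
    where open Stage (words s N) (s N)

  -- Diagonal avoidance of a sequence of reals

  module Gap (W : List ℕ) where
    m : ℕ
    m = 15 ℕ.* (den W ℕ.* den W)

    m≥1 : 1 ℕ.≤ m
    m≥1 = ℕ.*-mono-≤ {1} {15} (s≤s z≤n) (ℕ.*-mono-≤ (den≥1 W) (den≥1 W))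

    8m≥1 : 1 ℕ.≤ 8 ℕ.* m
    8m≥1 = ℕ.*-mono-≤ {1} {8} (s≤s z≤n) m≥1

    u : ℚ
    u = inv (ι (8 ℕ.* m)) (ι>0 8m≥1)

    u>0 : 0ℚ ℚ.< u
    u>0 = inv>0 (ι (8 ℕ.* m)) (ι>0 8m≥1)

    8mu≡1 : ι (8 ℕ.* m) ℚ.* u ≡ 1ℚ
    8mu≡1 = p*inv (ι (8 ℕ.* m)) (ι>0 8m≥1)

    separation : ∃ λ u → 0ℚ ℚ.< u ×
      (((u ℚ.+ u) ℚ.+ (u ℚ.+ u)) ℚ.+ ((u ℚ.+ u) ℚ.+ (u ℚ.+ u)) ℚ.≤
        ℚ.∣ value (next W false) ℚ.- value (next W true) ∣) ×
      (∀ b V → ℚ.∣ value (next W b ++ V) ℚ.- value (next W b) ∣ ℚ.≤ u)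
    separation = u , u>0 ,
      eight-units {u} {ℚ.∣ value (next W false) ℚ.- value (next W true) ∣} {m} m≥1 8mu≡1 (digit-separation W (Stage.w W false) (Stage.w W true)) ,
      λ b V → value-close-≤ (next W b) V (8 ℕ.* m) 8mu≡1 8m≥1 (120s²≤ {den W} (Stage.11*den≤den W b))

  Separates : List ℕ → ℝ → Bool → Set
  Separates W y b = ∃ λ u → 0ℚ ℚ.< u × ∃ λ N →
    (∀ n → N ℕ.≤ n → ∀ V → value (next W b ++ V) ℚ.+ u ℚ.≤ seq y n) ⊎
    (∀ n → N ℕ.≤ n → ∀ V → seq y n ℚ.+ u ℚ.≤ value (next W b ++ V))

  abstract
    separate : ∀ W y → ∃ (Separates W y)
    separate W y = let
        u , u>0 , far , radius = Gap.separation W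
        b , N , away = avoid (λ b V → value (next W b ++ V)) (λ b → value (next W b)) u>0 far radius y
      in b , u , u>0 , N , away

  separates⇒# : ∀ s j {W y b} → words s (suc j) ≡ next W b → Separates W y b → limit s # y
  separates⇒# s j {W} {y} {b} ws≡ (u , u>0 , N , away) = conclude away
    where
    member : ∀ {n} → suc j ℕ.≤ n → ∃ λ V → next W b ++ V ≡ words s n
    member le = let V , eq = words-extend s (suc j) le in V , sym (trans eq (cong (_++ V) ws≡))

    conclude : (∀ n → N ℕ.≤ n → ∀ V → value (next W b ++ V) ℚ.+ u ℚ.≤ seq y n) ⊎
               (∀ n → N ℕ.≤ n → ∀ V → seq y n ℚ.+ u ℚ.≤ value (next W b ++ V)) →
               limit s # y
    conclude (inj₁ below) = inj₁ (u , u>0 , suc j ℕ.⊔ N , λ n le →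
      let V , eq = member (ℕ.m⊔n≤o⇒m≤o (suc j) N le) in
      subst (λ z → value z ℚ.+ u ℚ.≤ seq y n) eq (below n (ℕ.m⊔n≤o⇒n≤o (suc j) N le) V))
    conclude (inj₂ above) = inj₂ (u , u>0 , suc j ℕ.⊔ N , λ n le →
      let V , eq = member (ℕ.m⊔n≤o⇒m≤o (suc j) N le) in
      subst (λ z → seq y n ℚ.+ u ℚ.≤ value z) eq (above n (ℕ.m⊔n≤o⇒n≤o (suc j) N le) V))

  module Diagonal (f : ℕ → ℝ) where
    -- Each bit depends on the word built from the earlier bits. The recursion therefore runs on
    -- words, the bits are read off afterwards, and `words-choice` checks that they lead back to
    -- these words.
    avoiding : ℕ → List ℕ
    avoiding zero    = []
    avoiding (suc j) = next (avoiding j) (proj₁ (separate (avoiding j) (f j)))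

    choice : ℕ → Bool
    choice j = proj₁ (separate (avoiding j) (f j))

    words-choice : ∀ j → words choice j ≡ avoiding j
    words-choice zero    = refl
    words-choice (suc j) = cong (λ W → next W (choice j)) (words-choice j)

    limit-# : ∀ j → limit choice # f j
    limit-# j = separates⇒# choice j {avoiding j} {f j} {choice j} (words-choice (suc j))
      (proj₂ (separate (avoiding j) (f j)))

  -- The range of `limit` is saturated under `≃`, so that membership depends on the real and not on
  -- its representing sequence; the effective description of `B` is then its definition.
  B : Pred ℝ 0ℓ
  B β = ∃ λ s → β ≃ limit s

  B⊆Bad : B ⊆ Bad
  B⊆Bad {β} (s , β≃) = Bad-resp-≃ {limit s} {β} (≃-sym {β} {limit s} β≃) (limit-bad s)

  B-uncountable : Uncountable B
  B-uncountable f = limit choice , (choice , ≃-refl {limit choice}) , limit-#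
    where open Diagonal f

  B-littlewood : ∀ β → β ∈ B → Infinitely λ q → littlewood α β q ≤
    1/[ fromℕ q * φ q ] (*-pos {fromℕ q} {φ q} (fromℕ-pos q) (φ>0 q))
  B-littlewood β (s , β≃) N =
    let q , q≢0 , N≤q , le = limit-littlewood s N
    in q , q≢0 , N≤q , ≃-≤-trans {littlewood α β q {{q≢0}}} {littlewood α (limit s) q {{q≢0}}}
         {1/[ fromℕ q * φ q {{q≢0}} ] (*-pos {fromℕ q} {φ q {{q≢0}}} (fromℕ-pos q {{q≢0}}) (φ>0 q {{q≢0}}))}
         (littlewood-cong α {β} {limit s} q {{q≢0}} β≃) le

theorem1 : (φ : Family) →
    (φ>0 : ∀ q .{{_ : NonZero q}} → 0ℝ < φ q) →
    NonIncreasing φ →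
    φ 1 ≃ 1ℝ →
    ConvergesTo φ 0ℝ →
    TendsToInfinity (λ q → fromℕ q * φ q) →
    (α : ℝ) → α ∈ Bad →
    ∃ λ (B : Pred ℝ 0ℓ) →
    B ⊆ Bad ×
    Uncountable B ×
    (∀ β → β ∈ B → Infinitely λ q →
    littlewood α β q ≤ 1/[ fromℕ q * φ q ] (*-pos {fromℕ q} {φ q} (fromℕ-pos q) (φ>0 q))) ×
    (∀ β → β ∈ B → IsInfimum (littlewood α β) 0ℝ) ×
    EffectivelyConstructed B
theorem1 φ φ>0 _ _ φ→0 qφ→∞ α α∈Bad =
  let K , α-bad = bad⇒badWith {α} α∈Bad
      open Construction φ φ>0 φ→0 {K} {α} α-bad
  in B , (λ {β} → B⊆Bad {β}) , B-uncountable , B-littlewood ,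
     (λ β β∈B → infimum-zero {φ} φ>0 qφ→∞ α β (B-littlewood β β∈B)) ,
     limit , (λ {s} {t} → limit-cong {s} {t}) , λ β → mk⇔ (λ β∈B → β∈B) (λ β∈B → β∈B)
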